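{- Let $P$ be a tree poset of height $h$, and suppose there is an element $x\in P$ with the following property: for every $\varepsilon>0$ there exists $\delta>0$ such that for every sufficiently large $n\in\mathbb N$, every family $\mathcal F\subseteq 2^{[n]}$ with $|\mathcal F|\ge (h-1+\varepsilon)\binom{n}{\lfloor n/2\rfloor}$ contains a copy of the blow-up $P(x,\delta n)$. Then the number of $P$-free families in $2^{[n]}$ is $$2^{(h-1+o(1))\binom{n}{\lfloor n/2\rfloor}}\quad (n\to\infty).$$
   Context: Posets are finite collections of finite sets ordered by inclusion. A poset homomorphism $\phi:P\to Q$ is a map with $A\subseteq B\Rightarrow \phi(A)\subseteq\phi(B)$. $P$ is a subposet of $Q$ (and $Q$ "contains a copy of $P$") if there is an injective poset homomorphism $P\to Q$; otherwise $Q$ is $P$-free. The Hasse diagram of $P$ is the directed graph on $P$ with an edge $A\to B$ when $A\subsetneq B$ and no $C\in P$ has $A\subsetneq C\subsetneq B$; the undirected Hasse diagram forgets orientations. A tree poset is a poset whose undirected Hasse diagram is a tree. The height $h(P)$ is the number of elements of a longest chain in $P$. For a tree poset $P$, $x\in P$ and an integer $d\ge2$, the $d$-blow-up $P(x,d)$ rooted at $x$ is the tree poset whose Hasse diagram is obtained as follows: each $u\in P$ at distance $\rho$ from $x$ in the undirected Hasse diagram is replaced by $d^{\rho}$ elements $u^1,\dots,u^{d^\rho}$; for each edge $uv$ of the Hasse diagram with $v$ at distance $\rho-1$ from $x$ (and $u$ at distance $\rho$), the $u^i$ are partitioned into $d^{\rho-1}$ disjoint sets $U^1,\dots,U^{d^{\rho-1}}$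 of size $d$ and $v^j$ is joined to every element of $U^j$, with the same orientation as the edge $uv$. Non-integer blow-up parameters such as $\delta n$ are rounded down to integers. -}

module Defs where

open import Data.Fin using (Fin; toℕ; finToFun; funToFin)
open import Data.Fin.Properties using (any?; all?; finToFun-funToFin)
import Data.Fin.Properties as Fin
open import Data.Fin.Subset using (Subset; inside; outside; _⊆_)
open import Data.Fin.Subset.Properties using (⊆-poset; _⊆?_)
open import Data.Bool.Properties using () renaming (_≟_ to _≟ᵇ_)
import Data.Integer as ℤ
open import Data.Integer using (+_; -[1+_])
open import Data.List using (List; []; _∷_; _++_; [_]; map; length; lookup; filter)
open import Data.List.Relation.Unary.AllPairs using (AllPairs)
open import Data.List.Relation.Unary.Linked using (Linked)
open import Data.List.Relation.Unary.Unique.Propositional using (Unique)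
open import Data.Nat as ℕ using (ℕ; zero; suc; _^_; ⌊_/2⌋; z≤n; s≤s)
open import Data.Nat.Combinatorics using (_C_)
open import Data.Product using (Σ-syntax; ∃-syntax; _×_; _,_; proj₁; proj₂)
open import Data.Rational.Unnormalised using (ℚᵘ; ↥_; ↧ₙ_; _/_)
open import Data.Sum using (_⊎_; inj₁; inj₂)
open import Data.Vec using ([]; _∷_)
open import Data.Vec.Properties using (≡-dec)
open import Function using (_∘_)
open import Function.Bundles using (_⇔_; mk⇔)
open import Function.Definitions using (Injective)
open import Level using (0ℓ)
open import Relation.Binary using (Rel; Poset; IsDecPartialOrder)
open import Relation.Binary.Construct.Closure.ReflexiveTransitive using (Star; ε; _◅_; _◅◅_)
open import Relation.Binary.Construct.Closure.Symmetric using (SymClosure; fwd; bwd)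
import Relation.Binary.Construct.On as On
open import Relation.Binary.Definitions using (Decidable)
open import Relation.Binary.Morphism.Structures using (IsOrderHomomorphism)
open import Relation.Binary.PropositionalEquality
  using (_≡_; _≢_; refl; sym; cong; subst₂; isEquivalence)
import Relation.Binary.Properties.Poset as PosetProperties
open import Relation.Nullary using (¬_; Dec; yes; no; contradiction)
open import Relation.Nullary.Decidable using (map′; ¬?; _×-dec_; _⊎-dec_; _→-dec_)

infix 4 _↪_

-- Only monotonicity and injectivity are required: the order need not be
-- reflected (so this is weaker than the library's IsOrderMonomorphism).
_↪_ : Poset 0ℓ 0ℓ 0ℓ → Poset 0ℓ 0ℓ 0ℓ → Set
P ↪ Q = Σ[ f ∈ (P.Carrier → Q.Carrier) ]
          IsOrderHomomorphism P._≈_ Q._≈_ P._≤_ Q._≤_ f × Injective P._≈_ Q._≈_ f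
  where
  module P = Poset P
  module Q = Poset Q

Hasse : (P : Poset 0ℓ 0ℓ 0ℓ) → Rel (Poset.Carrier P) 0ℓ
Hasse P u v = u < v × (∀ w → ¬ (u < w × w < v))
  where open PosetProperties P using (_<_)

-- Finite posets are taken up to isomorphism, on the carrier Fin size.  Every
-- finite collection of finite sets ordered by inclusion is of this form.
record FinPoset : Set₁ where
  infix 4 _≤_
  field
    size              : ℕ
    _≤_               : Rel (Fin size) 0ℓ
    isDecPartialOrder : IsDecPartialOrder _≡_ _≤_

  open IsDecPartialOrder isDecPartialOrder public
    using (isPartialOrder; _≤?_)
    renaming (refl to ≤-refl; trans to ≤-trans; antisym to ≤-antisym)

  Element : Set
  Element = Fin size

  poset : Poset 0ℓ 0ℓ 0ℓ
  poset = record { isPartialOrder = isPartialOrder }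

  open PosetProperties poset public using (_<_)

  _<?_ : Decidable _<_
  u <? v = (u ≤? v) ×-dec ¬? (u Fin.≟ v)

  hasse? : Decidable (Hasse poset)
  hasse? u v = (u <? v) ×-dec all? (λ w → ¬? ((u <? w) ×-dec (w <? v)))

  UndirectedHasse : Rel Element 0ℓ
  UndirectedHasse = SymClosure (Hasse poset)

  undirectedHasse? : Decidable UndirectedHasse
  undirectedHasse? u v =
    map′ (λ { (inj₁ e) → fwd e ; (inj₂ e) → bwd e })
         (λ { (fwd e) → inj₁ e ; (bwd e) → inj₂ e })
         (hasse? u v ⊎-dec hasse? v u)

  Chain : List Element → Set
  Chain us = Unique us × AllPairs (λ u v → u ≤ v ⊎ v ≤ u) us

  IsHeight : ℕ → Set
  IsHeight h = (∃[ us ] Chain us × length us ≡ h)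
             × (∀ us → Chain us → length us ℕ.≤ h)

walkLength : {A : Set} {_~_ : Rel A 0ℓ} {u v : A} → Star _~_ u v → ℕ
walkLength ε       = 0
walkLength (_ ◅ w) = suc (walkLength w)

Walk : {A : Set} → Rel A 0ℓ → ℕ → Rel A 0ℓ
Walk _~_ m u v = Σ[ w ∈ Star _~_ u v ] walkLength w ≡ m

IsDistance : {A : Set} → Rel A 0ℓ → A → A → ℕ → Set
IsDistance _~_ u v ρ = Walk _~_ ρ u v × (∀ m → Walk _~_ m u v → ρ ℕ.≤ m)

record IsTreeGraph {A : Set} (_~_ : Rel A 0ℓ) : Set where
  field
    connected : ∀ u v → Star _~_ u v
    acyclic   : ∀ v vs → Unique (v ∷ vs) → 3 ℕ.≤ length (v ∷ vs) →
                ¬ Linked _~_ (v ∷ vs ++ [ v ])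

IsTree : FinPoset → Set
IsTree P = IsTreeGraph (FinPoset.UndirectedHasse P)

private
  least : {P : ℕ → Set} → (∀ m → Dec (P m)) → ∀ m → P m →
          ∃[ ρ ] P ρ × (∀ k → P k → ρ ℕ.≤ k)
  least P? m       p with P? 0
  least P? m       p | yes p₀ = 0 , p₀ , λ _ _ → z≤n
  least P? zero    p | no ¬p₀ = contradiction p ¬p₀
  least P? (suc m) p | no ¬p₀ with least (P? ∘ suc) m p
  ... | ρ , pρ , min = suc ρ , pρ , λ
    { zero    p₀ → contradiction p₀ ¬p₀
    ; (suc k) pₖ → s≤s (min k pₖ) }

  walk? : ∀ {k} {_~_ : Rel (Fin k) 0ℓ} → Decidable _~_ → ∀ m → Decidable (Walk _~_ m)
  walk? _~?_ zero u v =
    map′ (λ { refl → ε , refl }) (λ { (ε , _) → refl }) (u Fin.≟ v)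
  walk? _~?_ (suc m) u v =
    map′ (λ { (_ , e , w , eq) → e ◅ w , cong suc eq })
         (λ { (e ◅ w , refl) → _ , e , w , refl })
         (any? (λ t → (u ~? t) ×-dec walk? _~?_ m t v))

distance : (P : FinPoset) → IsTree P → ∀ u v →
           ∃[ ρ ] IsDistance (FinPoset.UndirectedHasse P) u v ρ
distance P tree u v =
  least (λ m → walk? (FinPoset.undirectedHasse? P) m u v) _
        (IsTreeGraph.connected tree u v , refl)

-- Blow-ups are meant for d ≥ 2, but the construction makes sense for every d.
module BlowUp (P : FinPoset) (tree : IsTree P) (x : FinPoset.Element P) (d : ℕ) where
  open FinPoset P

  dist : Element → ℕ
  dist u = proj₁ (distance P tree x u)

  Copy : Set
  Copy = Σ[ u ∈ Element ] Fin (d ^ dist u)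

  -- Copies are indexed from 0.  The copies of u with indices j d, …, j d + d − 1 form the block Uʲ that is
  -- joined to vʲ.
  InBlock : Copy → Copy → Set
  InBlock (u , i) (v , j) =
    dist u ≡ suc (dist v) × (∃[ r ] toℕ i ≡ toℕ j ℕ.* d ℕ.+ toℕ {d} r)

  Edge : Rel Copy 0ℓ
  Edge a b = Hasse poset (proj₁ a) (proj₁ b) × (InBlock a b ⊎ InBlock b a)

  private
    edge⇒< : ∀ {a b} → Edge a b → proj₁ a < proj₁ b
    edge⇒< ((a<b , _) , _) = a<b

    star⇒≤ : ∀ {a b} → Star Edge a b → proj₁ a ≤ proj₁ b
    star⇒≤ ε        = ≤-refl
    star⇒≤ (e ◅ es) = ≤-trans (proj₁ (edge⇒< e)) (star⇒≤ es)

    <-≤⇒≢ : ∀ {u v w} → u < v → v ≤ w → u ≢ w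
    <-≤⇒≢ (u≤v , u≢v) v≤w refl = u≢v (≤-antisym u≤v v≤w)

    edge-antisym : ∀ {a b} → Star Edge a b → Star Edge b a → a ≡ b
    edge-antisym ε        _  = refl
    edge-antisym (e ◅ es) fs =
      contradiction refl (<-≤⇒≢ (edge⇒< e) (≤-trans (star⇒≤ es) (star⇒≤ fs)))

  blowUp : Poset 0ℓ 0ℓ 0ℓ
  blowUp = record
    { Carrier = Copy
    ; _≈_     = _≡_
    ; _≤_     = Star Edge
    ; isPartialOrder = record
      { isPreorder = record
        { isEquivalence = isEquivalence
        ; reflexive     = λ { refl → ε }
        ; trans         = _◅◅_
        }
      ; antisym = edge-antisym
      }
    }

  hasse⇔edge : ∀ {a b} → Hasse blowUp a b ⇔ Edge a b
  hasse⇔edge {a} {b} = mk⇔ to from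
    where
    open PosetProperties blowUp using () renaming (_<_ to _⊏_)

    edge⇒⊏ : ∀ {a b} → Edge a b → a ⊏ b
    edge⇒⊏ e = (e ◅ ε) , λ { refl → proj₂ (edge⇒< e) refl }

    ⊏⇒< : ∀ {a b} → a ⊏ b → proj₁ a < proj₁ b
    ⊏⇒< (ε      , a≢a) = contradiction refl a≢a
    ⊏⇒< (e ◅ es , _)   = star⇒≤ (e ◅ es) , <-≤⇒≢ (edge⇒< e) (star⇒≤ es)

    to : Hasse blowUp a b → Edge a b
    to ((ε             , a≢a) , _)   = contradiction refl a≢a
    to ((e ◅ ε         , _)   , _)   = e
    to ((e ◅ (f ◅ fs)  , _)   , min) = contradiction
      (edge⇒⊏ e , f ◅ fs , λ { refl → <-≤⇒≢ (edge⇒< f) (star⇒≤ fs) refl })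
      (min _)

    from : Edge a b → Hasse blowUp a b
    from e = edge⇒⊏ e , λ w (a⊏w , w⊏b) → proj₂ (proj₁ e) (proj₁ w) (⊏⇒< a⊏w , ⊏⇒< w⊏b)

open BlowUp public using (blowUp)

-- A family of subsets of [n] is a duplicate-free list.  Its poset consists of the
-- positions in the list, ordered by inclusion of the sets they hold; positions
-- holding the same set are identified.
familyPoset : ∀ {n} → List (Subset n) → Poset 0ℓ 0ℓ 0ℓ
familyPoset {n} F = On.poset (⊆-poset n) (lookup F)

Contains : ∀ {n} → List (Subset n) → Poset 0ℓ 0ℓ 0ℓ → Set
Contains F P = P ↪ familyPoset F

Free : ∀ {n} → FinPoset → List (Subset n) → Set
Free P F = ¬ Contains F (FinPoset.poset P)

contains? : ∀ {n} (F : List (Subset n)) (P : FinPoset) → Dec (Contains F (FinPoset.poset P))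
contains? {n} F P =
  map′ (λ (c , good) → finToFun c
                     , record { cong = cong (lookup F ∘ finToFun c)
                              ; mono = λ {u} {v} → proj₁ (good u v) }
                     , λ {u} {v} → proj₂ (good u v))
       (λ (f , hom , inj) → funToFin f , λ u v →
            subst₂ (Good u v) (sym (finToFun-funToFin f u)) (sym (finToFun-funToFin f v))
                   (IsOrderHomomorphism.mono hom , inj))
       (any? λ c → all? λ u → all? λ v → good? u v (finToFun c u) (finToFun c v))
  where
  open FinPoset P

  Good : (u v : Element) (i j : Fin (length F)) → Set
  Good u v i j = (u ≤ v → lookup F i ⊆ lookup F j) × (lookup F i ≡ lookup F j → u ≡ v)

  good? : ∀ u v i j → Dec (Good u v i j)
  good? u v i j = ((u ≤? v) →-dec (lookup F i ⊆? lookup F j))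
            ×-dec (≡-dec _≟ᵇ_ (lookup F i) (lookup F j) →-dec (u Fin.≟ v))

free? : ∀ {n} (P : FinPoset) (F : List (Subset n)) → Dec (Free P F)
free? P F = ¬? (contains? F P)

subsets : ∀ n → List (Subset n)
subsets zero    = [ [] ]
subsets (suc n) = map (outside ∷_) (subsets n) ++ map (inside ∷_) (subsets n)

sublists : {A : Set} → List A → List (List A)
sublists []       = [ [] ]
sublists (x ∷ xs) = sublists xs ++ map (x ∷_) (sublists xs)

-- subsets n lists every subset of [n] exactly once, so its sublists represent
-- every family in 2^[n] exactly once.
numberOfFree : FinPoset → ℕ → ℕ
numberOfFree P n = length (filter (free? P) (sublists (subsets n)))

fromℕ : ℕ → ℚᵘ
fromℕ m = + m / 1

middle : ℕ → ℚᵘ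
middle n = fromℕ (n C ⌊ n /2⌋)

-- m ≤ 2^(a/b) and 2^(a/b) ≤ m, raised to the power b.  A negative a is moved
-- to the other side.

infix 4 _≤2^_ 2^_≤_

_≤2^_ : ℕ → ℚᵘ → Set
m ≤2^ q with ↥ q
... | + a      = m ^ (↧ₙ q) ℕ.≤ 2 ^ a
... | -[1+ a ] = m ^ (↧ₙ q) ℕ.* 2 ^ suc a ℕ.≤ 1

2^_≤_ : ℚᵘ → ℕ → Set
2^ q ≤ m with ↥ q
... | + a      = 2 ^ a ℕ.≤ m ^ (↧ₙ q)
... | -[1+ a ] = 1 ℕ.≤ m ^ (↧ₙ q) ℕ.* 2 ^ suc a

{-# OPTIONS --safe #-}
module Submission where

-- The lower bound counts the subfamilies of the h − 1 middle layers, which contain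
-- no chain of h distinct sets.
--
-- The upper bound is a container argument.  Let A be a family that still contains a
-- blow-up of P with blocks of size d ~ δn, and let I ⊆ A be P-free.  Ask whether the
-- root of the blow-up lies in I; then, for one vertex u after another, search for an
-- element of I in the block of copies of u joined to the copy already found for the
-- parent of u.  Every question deletes a set from A.  The search cannot find a copy of every vertex, as
-- these would form a copy of P in I.  So it ends with the answer no for the root, or,
-- after at most |P| answers yes, with d answers no for a whole block.  Hence the
-- answers yes number at most |P| 2^n/d in total until A has no more than
-- (h − 1 + ε/2) binom(n, n/2) elements, and the 0/1-sequences of length 2^n with so
-- few ones are only 2^(O(2^n log n / n)) = 2^(o(binom(n, n/2))) in number.

open import Defs
open import Data.Fin using (Fin)
import Data.Fin as Fin
import Data.Fin.Properties as Fin
open import Data.Fin.Subset using (Subset)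
open import Data.List using (List; []; _∷_; [_]; _++_; length; lookup; map; filter; allFin)
open import Data.List.Properties using (length-map; length-++; length-tabulate; filter-++)
open import Data.List.Membership.Propositional using (_∈_; _∉_)
open import Data.List.Membership.Propositional.Properties
  using (∈-∃++; ∈-allFin; ∈-++⁺ˡ; ∈-++⁺ʳ; ∈-lookup; ∈-map⁻)
import Data.List.Membership.DecPropositional as DecMembership
open import Data.List.Relation.Unary.All as All using (All; []; _∷_)
open import Data.List.Relation.Unary.AllPairs using (AllPairs; []; _∷_)
open import Data.List.Relation.Unary.Any as Any using (here; there)
open import Data.List.Relation.Unary.Unique.Propositional using (Unique)
import Data.List.Relation.Unary.Unique.Propositional.Properties as Unique
open import Data.Nat using (ℕ; zero; suc; _≥_; _^_; ⌊_/2⌋; NonZero; z≤n; s≤s)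
import Data.Nat as ℕ
import Data.Nat.Properties as ℕ
open import Data.Nat.Combinatorics using (_C_; nCk+nC[k+1]≡[n+1]C[k+1]; nC1≡n; nCk≡nC[n∸k])
import Data.Nat.Tactic.RingSolver as ℕ
open import Data.Product using (Σ-syntax; ∃-syntax; _×_; _,_; proj₁; proj₂)
open import Data.Sum using (_⊎_; inj₁; inj₂)
open import Function using (_∘_; id)
open import Level using (0ℓ)
open import Relation.Binary.PropositionalEquality
  using (_≡_; _≢_; refl; sym; trans; cong; cong₂; subst; subst₂; setoid; module ≡-Reasoning)
open import Relation.Nullary using (¬_; Dec; yes; no; does; contradiction)
open import Relation.Nullary.Decidable using (_×-dec_; ¬?; decidable-stable)
open import Relation.Unary using (Pred; Decidable)
import Algebra.Properties.CommutativeSemigroup as CommutativeSemigroup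

module +-CS = CommutativeSemigroup ℕ.+-commutativeSemigroup
module *-CS = CommutativeSemigroup ℕ.*-commutativeSemigroup

-- Weighted counts of subfamilies, and the search through a blow-up.

module Tallies where
  open import Data.Bool using (true; false)
  import Data.List.Relation.Binary.Permutation.Propositional as Perm
  open Perm using (_↭_; ↭-sym; ↭⇒↭ₛ)
  open import Data.List.Relation.Binary.Permutation.Propositional.Properties
    using (∈-resp-↭; ↭-length; shift; ++⁺ˡ)
  import Data.List.Relation.Binary.Permutation.Setoid.Properties as Setoid
  open import Data.List.Relation.Binary.Subset.Propositional using (_⊆_)
  open import Data.Nat
  open import Data.Nat.Properties

  private variable
    X : Set
    A B S : List X

  -- The sum of w over `sublists A`, arranged so that one unfolding is one question: the summands
  -- count the sublists without and with the head.
  tally : (List X → ℕ) → List X → ℕ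
  tally w []      = w []
  tally w (y ∷ A) = tally w A + tally (w ∘ (y ∷_)) A

  tally-mono : {v w : List X → ℕ} → (∀ F → v F ≤ w F) → ∀ A → tally v A ≤ tally w A
  tally-mono v≤w []      = v≤w []
  tally-mono v≤w (y ∷ A) = +-mono-≤ (tally-mono v≤w A) (tally-mono (v≤w ∘ (y ∷_)) A)

  tally-zero : {w : List X → ℕ} → (∀ F → w F ≡ 0) → ∀ A → tally w A ≡ 0
  tally-zero w≡0 []      = w≡0 []
  tally-zero w≡0 (y ∷ A) = cong₂ _+_ (tally-zero w≡0 A) (tally-zero (w≡0 ∘ (y ∷_)) A)

  tally-cong : {v w : List X → ℕ} → (∀ F → v F ≡ w F) → ∀ A → tally v A ≡ tally w A
  tally-cong v≡w []      = v≡w []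
  tally-cong v≡w (y ∷ A) = cong₂ _+_ (tally-cong v≡w A) (tally-cong (v≡w ∘ (y ∷_)) A)

  -- The search asks about elements anywhere in A; a permutation brings the element in question to
  -- the front.
  tally-resp-↭ : {w : List X → ℕ} → (∀ {F G} → F ↭ G → w F ≡ w G) →
                 A ↭ B → tally w A ≡ tally w B
  tally-resp-↭ w-resp Perm.refl = refl
  tally-resp-↭ w-resp (Perm.prep y A↭B) =
    cong₂ _+_ (tally-resp-↭ w-resp A↭B) (tally-resp-↭ (w-resp ∘ Perm.prep y) A↭B)
  tally-resp-↭ {w = w} w-resp (Perm.swap {A} {B} y z A↭B) = begin
    (tally w A + wz A) + (wy A + wyz A)   ≡⟨ +-CS.interchange (tally w A) (wz A) (wy A) (wyz A) ⟩
    (tally w A + wy A) + (wz A + wyz A)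
      ≡⟨ cong₂ _+_ (cong₂ _+_ (tally-resp-↭ w-resp A↭B) (tally-resp-↭ (w-resp ∘ Perm.prep y) A↭B))
                   (cong₂ _+_ (tally-resp-↭ (w-resp ∘ Perm.prep z) A↭B)
                     (trans (tally-cong (λ _ → w-resp (Perm.swap y z Perm.refl)) A)
                              (tally-resp-↭ (w-resp ∘ Perm.prep z ∘ Perm.prep y) A↭B))) ⟩
    (tally w B + wy B) + (wz B + tally (λ F → w (z ∷ y ∷ F)) B) ∎
    where
    open ≡-Reasoning
    wy  = tally (w ∘ (y ∷_))
    wz  = tally (w ∘ (z ∷_))
    wyz = tally (λ F → w (y ∷ z ∷ F))
  tally-resp-↭ w-resp (Perm.trans A↭B B↭C) =
    trans (tally-resp-↭ w-resp A↭B) (tally-resp-↭ w-resp B↭C)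

  tally≤2^ : {w : List X → ℕ} → (∀ F → w F ≤ 1) → ∀ A → tally w A ≤ 2 ^ length A
  tally≤2^ w≤1 []      = w≤1 []
  tally≤2^ w≤1 (y ∷ A) = +-mono-≤ (tally≤2^ w≤1 A)
    (≤-trans (tally≤2^ (w≤1 ∘ (y ∷_)) A) (m≤m+n _ 0))

  -- Every sublist of `filter Q? A` weighs at least 1; at an element failing Q only the sublists
  -- without it are kept.
  2^≤tally : {w : List X → ℕ} {Q : Pred X 0ℓ} (Q? : Decidable Q) →
             (∀ F → All Q F → 1 ≤ w F) → ∀ A → 2 ^ length (filter Q? A) ≤ tally w A
  2^≤tally Q? 1≤w [] = 1≤w [] []
  2^≤tally Q? 1≤w (y ∷ A) with Q? y
  ... | yes q = +-mono-≤ (2^≤tally Q? 1≤w A)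
                  (≤-trans (≤-reflexive (+-identityʳ _))
                           (2^≤tally Q? (λ F qs → 1≤w (y ∷ F) (q ∷ qs)) A))
  ... | no _  = ≤-trans (2^≤tally Q? 1≤w A) (m≤m+n _ _)

  indicator : {A : Set} → Dec A → ℕ
  indicator (yes _) = 1
  indicator (no _)  = 0

  indicator≤1 : {A : Set} (a? : Dec A) → indicator a? ≤ 1
  indicator≤1 (yes _) = ≤-refl
  indicator≤1 (no _)  = z≤n

  indicator-mono : {A B : Set} (a? : Dec A) (b? : Dec B) → (A → B) → indicator a? ≤ indicator b?
  indicator-mono (yes a) (yes b) f = ≤-refl
  indicator-mono (yes a) (no ¬b) f = contradiction (f a) ¬b
  indicator-mono (no ¬a) b?      f = z≤n

  indicator-true : {A : Set} (a? : Dec A) → A → 1 ≤ indicator a?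
  indicator-true (yes _) _ = ≤-refl
  indicator-true (no ¬a) a = contradiction a ¬a

  indicator-false : {A : Set} (a? : Dec A) → ¬ A → indicator a? ≡ 0
  indicator-false (yes a) ¬a = contradiction a ¬a
  indicator-false (no _)  _  = refl

  length-filter-map : {X Y : Set} {Q : Pred Y 0ℓ} (Q? : Decidable Q) (f : X → Y) (xs : List X) →
                      length (filter Q? (map f xs)) ≡ length (filter (Q? ∘ f) xs)
  length-filter-map Q? f []       = refl
  length-filter-map Q? f (x ∷ xs) with does (Q? (f x))
  ... | true  = cong suc (length-filter-map Q? f xs)
  ... | false = length-filter-map Q? f xs

  length-filter-sublists : {Q : Pred (List X) 0ℓ} (Q? : Decidable Q) (A : List X) →
                           length (filter Q? (sublists A)) ≡ tally (indicator ∘ Q?) A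
  length-filter-sublists Q? [] with Q? []
  ... | yes _ = refl
  ... | no _  = refl
  length-filter-sublists Q? (y ∷ A) = begin
    length (filter Q? (sublists A ++ map (y ∷_) (sublists A)))
      ≡⟨ cong length (filter-++ Q? (sublists A) _) ⟩
    length (filter Q? (sublists A) ++ filter Q? (map (y ∷_) (sublists A)))
      ≡⟨ length-++ (filter Q? (sublists A)) ⟩
    length (filter Q? (sublists A)) + length (filter Q? (map (y ∷_) (sublists A)))
      ≡⟨ cong₂ _+_ (length-filter-sublists Q? A)
           (trans (length-filter-map Q? (y ∷_) (sublists A))
                    (length-filter-sublists (Q? ∘ (y ∷_)) A)) ⟩
    tally (indicator ∘ Q?) A + tally (indicator ∘ Q? ∘ (y ∷_)) A ∎
    where open ≡-Reasoning

  -- Counts the 0/1-sequences of length a with at most e ones.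
  sequences : ℕ → ℕ → ℕ
  sequences zero    e       = 1
  sequences (suc a) zero    = 1
  sequences (suc a) (suc e) = sequences a (suc e) + sequences a e

  1≤sequences : ∀ a e → 1 ≤ sequences a e
  1≤sequences zero    e       = ≤-refl
  1≤sequences (suc a) zero    = ≤-refl
  1≤sequences (suc a) (suc e) = ≤-trans (1≤sequences a (suc e)) (m≤m+n _ _)

  sequences-monoʳ : ∀ a {e f} → e ≤ f → sequences a e ≤ sequences a f
  sequences-monoʳ zero    _         = ≤-refl
  sequences-monoʳ (suc a) {f = f} z≤n = 1≤sequences (suc a) f
  sequences-monoʳ (suc a) (s≤s e≤f) =
    +-mono-≤ (sequences-monoʳ a (s≤s e≤f)) (sequences-monoʳ a e≤f)

  -- Expand (q + 1)^a over all 0/1-sequences of length a, each zero contributing a factor q: a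
  -- sequence with at most e ones contributes at least q^(a - e). The factor `q ^ e` avoids the
  -- subtraction.
  sequences-bound : ∀ q .{{_ : NonZero q}} a e → sequences a e * q ^ a ≤ suc q ^ a * q ^ e
  sequences-bound q zero e = begin
    1         ≤⟨ m^n>0 q e ⟩
    q ^ e     ≡⟨ +-identityʳ (q ^ e) ⟨
    q ^ e + 0 ∎
    where open ≤-Reasoning
  sequences-bound q (suc a) zero = begin
    q ^ suc a + 0 ≡⟨ +-identityʳ (q ^ suc a) ⟩
    q ^ suc a     ≤⟨ ^-monoˡ-≤ (suc a) (n≤1+n q) ⟩
    suc q ^ suc a ≡⟨ *-identityʳ (suc q ^ suc a) ⟨
    suc q ^ suc a * 1 ∎
    where open ≤-Reasoning
  sequences-bound q (suc a) (suc e) = begin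
    (sequences a (suc e) + sequences a e) * (q * q ^ a)
      ≡⟨ *-distribʳ-+ (q * q ^ a) (sequences a (suc e)) (sequences a e) ⟩
    sequences a (suc e) * (q * q ^ a) + sequences a e * (q * q ^ a)
      ≡⟨ cong₂ _+_ (*-CS.x∙yz≈y∙xz (sequences a (suc e)) q (q ^ a))
                   (*-CS.x∙yz≈y∙xz (sequences a e) q (q ^ a)) ⟩
    q * (sequences a (suc e) * q ^ a) + q * (sequences a e * q ^ a)
      ≤⟨ +-mono-≤ (*-monoʳ-≤ q (sequences-bound q a (suc e)))
                  (*-monoʳ-≤ q (sequences-bound q a e)) ⟩
    q * (suc q ^ a * q ^ suc e) + q * (suc q ^ a * q ^ e)
      ≡⟨ cong (q * (suc q ^ a * q ^ suc e) +_) (*-CS.x∙yz≈y∙xz q (suc q ^ a) (q ^ e)) ⟩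
    q * (suc q ^ a * q ^ suc e) + suc q ^ a * q ^ suc e
      ≡⟨ +-comm (q * (suc q ^ a * q ^ suc e)) (suc q ^ a * q ^ suc e) ⟩
    suc q * (suc q ^ a * q ^ suc e)
      ≡⟨ *-assoc (suc q) (suc q ^ a) (q ^ suc e) ⟨
    suc q ^ suc a * q ^ suc e ∎
    where open ≤-Reasoning

  extract : {y : X} → y ∈ A → ∃[ B ] A ↭ y ∷ B
  extract y∈A with ys , zs , refl ← ∈-∃++ y∈A = ys ++ zs , shift _ ys zs

  Unique-resp-↭ : A ↭ B → Unique A → Unique B
  Unique-resp-↭ A↭B = Setoid.Unique-resp-↭ (setoid _) (↭⇒↭ₛ A↭B)

  ∈-uncons : {y z : X} → A ↭ y ∷ B → z ∈ A → z ≢ y → z ∈ B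
  ∈-uncons A↭ z∈A z≢y with ∈-resp-↭ A↭ z∈A
  ... | here z≡y = contradiction z≡y z≢y
  ... | there z∈B = z∈B

  -- The copies of u are indexed by Ix u, and the d copies joined to the copy j of its
  -- parent are block u j.  The weight w stands for the indicator of being P-free.
  module Search
    {X : Set} {p : ℕ} (x : Fin p)
    (parent : Fin p → Fin p) (depth : Fin p → ℕ)
    (depth-parent : ∀ {u} → u ≢ x → depth u ≡ suc (depth (parent u)))
    (Ix : Fin p → Set) (default : ∀ u → Ix u) (d : ℕ)
    (InBlock : ∀ u → Ix u → Ix (parent u) → Set)
    (block : ∀ {u} → u ≢ x → (j : Ix (parent u)) →
       Σ[ f ∈ (Fin d → Ix u) ] (∀ {s t} → f s ≡ f t → s ≡ t) × (∀ t → InBlock u (f t) j))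
    (w : List X → ℕ) (w-antitone : ∀ {F G} → F ⊆ G → w G ≤ w F) (w≤1 : ∀ F → w F ≤ 1)
    where

    Consistent : (∀ u → Ix u) → Set
    Consistent idx = ∀ u → u ≢ x → InBlock u (idx u) (idx (parent u))

    -- All that the search uses of a copy of the blow-up. The order enters only through `kills`: one
    -- copy of each vertex, each in the block of its parent's copy, form a copy of P.
    record Blowup (A : List X) : Set where
      field
        place           : ∀ u → Ix u → X
        place∈          : ∀ u i → place u i ∈ A
        place-injective : ∀ {u v i j} → place u i ≡ place v j →
                          _≡_ {A = Σ[ u ∈ Fin p ] Ix u} (u , i) (v , j)
        kills           : ∀ idx → Consistent idx →
                          ∀ S → (∀ u → place u (idx u) ∈ S) → w S ≡ 0

    private
      open DecMembership (Fin._≟_ {p}) using (_∈?_)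

      w-resp : ∀ {F G} → F ↭ G → w F ≡ w G
      w-resp F↭G = ≤-antisym (w-antitone (∈-resp-↭ (↭-sym F↭G))) (w-antitone (∈-resp-↭ F↭G))

      update : (∀ u → Ix u) → ∀ u → Ix u → ∀ v → Ix v
      update idx u i v with v Fin.≟ u
      ... | yes refl = i
      ... | no _     = idx v

      update-other : ∀ idx {u v} i → v ≢ u → update idx u i v ≡ idx v
      update-other idx {u} {v} i v≢u with v Fin.≟ u
      ... | yes v≡u = contradiction v≡u v≢u
      ... | no _    = refl

      tallyOver : List X → List X → ℕ
      tallyOver S = tally (λ I → w (S ++ I))

      tallyOver≤tally : ∀ S A → tallyOver S A ≤ tally w A
      tallyOver≤tally S = tally-mono λ I → w-antitone (∈-++⁺ʳ S)

      -- One question about y, with S the sets answered yes so far: the first summand counts the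
      -- families answering no, the second those answering yes.
      tallyOver-split : ∀ S {y A B} → A ↭ y ∷ B →
                        tallyOver S A ≤ tallyOver S B + tallyOver (y ∷ S) B
      tallyOver-split S {y} {A} {B} A↭ = begin
        tallyOver S A
          ≡⟨ tally-resp-↭ (λ F↭G → w-resp (++⁺ˡ S F↭G)) A↭ ⟩
        tallyOver S B + tally (λ I → w (S ++ y ∷ I)) B
          ≤⟨ +-monoʳ-≤ _ (tally-mono (λ I → ≤-reflexive (w-resp (shift y S I))) B) ⟩
        tallyOver S B + tallyOver (y ∷ S) B ∎
        where open ≤-Reasoning

      ready : ∀ {todo} → x ∉ todo → ∀ k u → depth u ≤ k → u ∈ todo →
              ∃[ v ] v ∈ todo × parent v ∉ todo
      ready {todo} x∉ k u du≤k u∈ with parent u ∈? todo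
      ready x∉ k u du≤k u∈ | no pu∉ = u , u∈ , pu∉
      ready x∉ k u du≤k u∈ | yes pu∈ with ≤-trans (≤-reflexive (sym (depth-parent λ { refl → x∉ u∈ }))) du≤k
      ready x∉ (suc k) u du≤k u∈ | yes pu∈ | s≤s le = ready x∉ k (parent u) le pu∈

    -- `hyp` is the induction hypothesis of `tally-bound` for shorter families. It takes over when a
    -- whole block has been refused, since at most `d * r` sets then remain.
    module _ (K ℓ r : ℕ) {A₀ : List X} (β : Blowup A₀)
      (hyp : ∀ A → Unique A → length A ≤ ℓ → length A ≤ d * r →
             tally w A ≤ K * sequences (length A) (p * r)) where
      open Blowup β

      -- S holds the copies found so far, one for each vertex outside todo.
      explore : ∀ m todo → length todo ≡ m → Unique todo → x ∉ todo →
        ∀ idx S → (∀ u → u ∉ todo → place u (idx u) ∈ S) →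
        (∀ u → u ∉ todo → u ≢ x → parent u ∉ todo × InBlock u (idx u) (idx (parent u))) →
        ∀ A → Unique A → length A ≤ ℓ → length A ≤ d + d * r →
        (∀ u → u ∈ todo → ∀ i → place u i ∈ A) →
        tallyOver S A ≤ K * sequences (length A) (m + p * r)
      -- Every vertex has its copy in S, so no family containing S is P-free.
      explore zero [] _ _ _ idx S chosen consistent A _ _ _ _ = begin
        tallyOver S A ≡⟨ tally-zero (λ I → kills idx (λ u u≢x → proj₂ (consistent u (λ ()) u≢x))
                                       (S ++ I) (λ u → ∈-++⁺ˡ (chosen u (λ ())))) A ⟩
        0             ≤⟨ z≤n ⟩
        K * sequences (length A) (p * r) ∎
        where open ≤-Reasoning
      explore (suc m) todo@(u₀ ∷ _) |todo| todo! x∉ idx S chosen consistent A A! |A|≤ℓ |A|≤ todo⊆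
        with u , u∈ , pu∉ ← ready x∉ (depth u₀) u₀ ≤-refl (here refl)
        with rest , todo↭ ← extract u∈
        with Unique-resp-↭ todo↭ todo!
      ... | u≢rest ∷ rest! =
        search (allFin d) (Unique.allFin⁺ d) A A! |A|≤ℓ
          (subst (λ k → length A ≤ k + d * r) (sym (length-tabulate {n = d} id)) |A|≤) |A|≤
          (λ t _ → todo⊆ u u∈ (f t))
          (λ v v∈ → todo⊆ v (∈-resp-↭ (↭-sym todo↭) (there v∈)))
        where
        u≢x : u ≢ x
        u≢x refl = x∉ u∈
        f = proj₁ (block u≢x (idx (parent u)))
        f-injective = proj₁ (proj₂ (block u≢x (idx (parent u))))
        f-inBlock = proj₂ (proj₂ (block u≢x (idx (parent u))))
        u∉rest : u ∉ rest
        u∉rest u∈rest = All.lookup u≢rest u∈rest refl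
        rest⊆ : ∀ {v} → v ∈ rest → v ∈ todo
        rest⊆ v∈ = ∈-resp-↭ (↭-sym todo↭) (there v∈)
        ∉todo : ∀ {v} → v ∉ rest → v ≢ u → v ∉ todo
        ∉todo v∉ v≢u v∈ = v∉ (∈-uncons todo↭ v∈ v≢u)
        |rest| : length rest ≡ m
        |rest| = suc-injective (trans (sym (↭-length todo↭)) |todo|)

        chosen′ : ∀ t v → v ∉ rest → place v (update idx u (f t) v) ∈ place u (f t) ∷ S
        chosen′ t v v∉ with v Fin.≟ u
        ... | yes refl = here refl
        ... | no v≢u   = there (chosen v (∉todo v∉ v≢u))

        consistent′ : ∀ t v → v ∉ rest → v ≢ x → parent v ∉ rest ×
          InBlock v (update idx u (f t) v) (update idx u (f t) (parent v))
        consistent′ t v v∉ v≢x with v Fin.≟ u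
        ... | yes refl = pu∉ ∘ rest⊆ , subst (InBlock u (f t))
                (sym (update-other idx (f t) λ pu≡u → pu∉ (subst (_∈ todo) (sym pu≡u) u∈)))
                (f-inBlock t)
        ... | no v≢u with pv∉ , inBlock ← consistent v (∉todo v∉ v≢u) v≢x =
          pv∉ ∘ rest⊆ , subst (InBlock v (idx v))
                (sym (update-other idx (f t) λ pv≡u → pv∉ (subst (_∈ todo) (sym pv≡u) u∈)))
                inBlock

        -- The list ts holds the positions of the block not yet asked about. The bound with
        -- `length ts` tightens with every no and yields `hyp` at the end; the bound with d is
        -- carried along for the fresh block that is searched after a yes.
        search : ∀ ts → Unique ts → ∀ A → Unique A → length A ≤ ℓ →
          length A ≤ length ts + d * r → length A ≤ d + d * r →
          (∀ t → t ∈ ts → place u (f t) ∈ A) → (∀ v → v ∈ rest → ∀ i → place v i ∈ A) →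
          tallyOver S A ≤ K * sequences (length A) (suc m + p * r)
        -- The block is refused: the copies in S are forgotten and a new blow-up is sought in what
        -- remains of A.
        search [] _ A A! |A|≤ℓ |A|≤ _ _ _ = begin
          tallyOver S A                    ≤⟨ tallyOver≤tally S A ⟩
          tally w A                        ≤⟨ hyp A A! |A|≤ℓ |A|≤ ⟩
          K * sequences (length A) (p * r)
            ≤⟨ *-monoʳ-≤ K (sequences-monoʳ (length A) (m≤n+m (p * r) (suc m))) ⟩
          K * sequences (length A) (suc m + p * r) ∎
          where open ≤-Reasoning
        search (t ∷ ts) (t≢ts ∷ ts!) A A! |A|≤ℓ |A|≤ |A|≤′ ts⊆ rest⊆A
          with B , A↭ ← extract (ts⊆ t (here refl))
          with |A| ← ↭-length A↭
          with Unique-resp-↭ A↭ A!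
        ... | _ ∷ B! = begin
          tallyOver S A ≤⟨ tallyOver-split S A↭ ⟩
          tallyOver S B + tallyOver (place u (f t) ∷ S) B
            ≤⟨ +-mono-≤
                (search ts ts! B B! |B|≤ℓ |B|≤ |B|≤′
                   (λ s s∈ → ∈-uncons A↭ (ts⊆ s (there s∈)) λ eq →
                      All.lookup t≢ts s∈ (sym (same-index (place-injective eq))))
                   rest⊆B)
                (explore m rest |rest| rest! (x∉ ∘ rest⊆) (update idx u (f t)) (place u (f t) ∷ S)
                   (chosen′ t) (consistent′ t) B B! |B|≤ℓ
                   |B|≤′ rest⊆B) ⟩
          K * sequences (length B) (suc m + p * r) + K * sequences (length B) (m + p * r)
            ≡⟨ *-distribˡ-+ K (sequences (length B) (suc m + p * r)) _ ⟨
          K * sequences (suc (length B)) (suc m + p * r)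
            ≡⟨ cong (λ k → K * sequences k (suc m + p * r)) |A| ⟨
          K * sequences (length A) (suc m + p * r) ∎
          where
          open ≤-Reasoning
          |B|≤|A| : length B ≤ length A
          |B|≤|A| = ≤-trans (n≤1+n _) (≤-reflexive (sym |A|))
          |B|≤ℓ : length B ≤ ℓ
          |B|≤ℓ = ≤-trans |B|≤|A| |A|≤ℓ
          |B|≤′ : length B ≤ d + d * r
          |B|≤′ = ≤-trans |B|≤|A| |A|≤′
          |B|≤ : length B ≤ length ts + d * r
          |B|≤ = s≤s⁻¹ (≤-trans (≤-reflexive (sym |A|)) |A|≤)
          same-index : ∀ {s} → _≡_ {A = Σ[ u ∈ Fin p ] Ix u} (u , f s) (u , f t) → s ≡ t
          same-index eq = f-injective (aux eq)
            where
            aux : ∀ {i j : Ix u} → _≡_ {A = Σ[ u ∈ Fin p ] Ix u} (u , i) (u , j) → i ≡ j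
            aux refl = refl
          rest⊆B : ∀ v → v ∈ rest → ∀ i → place v i ∈ B
          rest⊆B v v∈ i = ∈-uncons A↭ (rest⊆A v v∈ i) λ eq →
            u∉rest (subst (_∈ rest) (cong proj₁ (place-injective eq)) v∈)

    -- Each refused block removes d sets, so r of them exhaust A; between two refusals there are at
    -- most p answers yes. The factor `2 ^ T` counts the subfamilies of what is left when no blow-up
    -- is guaranteed any more.
    tally-bound : ∀ T → (∀ A → Unique A → T < length A → Blowup A) →
      ∀ r A → Unique A → length A ≤ d * r →
      tally w A ≤ 2 ^ T * sequences (length A) (p * r)
    tally-bound T blowup r A A! = go (length A) r A A! ≤-refl
      where
      -- The recursion is on a bound ℓ for the length, because a no at the root shortens A without
      -- lowering r.
      go : ∀ ℓ r A → Unique A → length A ≤ ℓ → length A ≤ d * r →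
           tally w A ≤ 2 ^ T * sequences (length A) (p * r)
      go ℓ r A A! |A|≤ℓ |A|≤dr with T <? length A
      ... | no T≮ = begin
        tally w A    ≤⟨ tally≤2^ w≤1 A ⟩
        2 ^ length A ≤⟨ ^-monoʳ-≤ 2 (≮⇒≥ T≮) ⟩
        2 ^ T        ≡⟨ *-identityʳ (2 ^ T) ⟨
        2 ^ T * 1    ≤⟨ *-monoʳ-≤ (2 ^ T) (1≤sequences (length A) (p * r)) ⟩
        2 ^ T * sequences (length A) (p * r) ∎
        where open ≤-Reasoning
      go zero r A A! |A|≤ℓ |A|≤dr | yes T< = contradiction (≤-trans T< |A|≤ℓ) λ ()
      go (suc ℓ) zero A A! |A|≤ℓ |A|≤dr | yes T< =
        contradiction (≤-trans T< (≤-trans |A|≤dr (≤-reflexive (*-zeroʳ d)))) λ ()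
      go (suc ℓ) (suc r) A A! |A|≤ℓ |A|≤dr | yes T<
        with β ← blowup A A! T<
        with B , A↭ ← extract (Blowup.place∈ β x (default x))
        with todo , all↭ ← extract (∈-allFin x)
        with |A| ← ↭-length A↭
        with Unique-resp-↭ A↭ A! | Unique-resp-↭ all↭ (Unique.allFin⁺ p)
      ... | _ ∷ B! | x≢todo ∷ todo! = begin
        tally w A                     ≡⟨ tally-resp-↭ w-resp A↭ ⟩
        tally w B + tallyOver [ y ] B
          ≤⟨ +-mono-≤ (go ℓ (suc r) B B! |B|≤ℓ (≤-trans |B|≤|A| |A|≤dr))
               (explore (2 ^ T) ℓ r β (go ℓ r) (length todo) todo refl todo!
                  (λ x∈ → All.lookup x≢todo x∈ refl) default [ y ]
                  (λ u u∉ → here (cong (λ v → place v (default v)) (∉todo u∉)))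
                  (λ u u∉ u≢x → contradiction (∉todo u∉) u≢x) B B! |B|≤ℓ
                  (≤-trans |B|≤|A| (≤-trans |A|≤dr (≤-reflexive (*-suc d r))))
                  λ u u∈ i → ∈-uncons A↭ (place∈ u i) λ eq →
                    All.lookup x≢todo u∈ (sym (cong proj₁ (place-injective eq)))) ⟩
        2 ^ T * sequences (length B) (p * suc r) + 2 ^ T * sequences (length B) e
          ≡⟨ cong (λ e′ → 2 ^ T * sequences (length B) e′ + 2 ^ T * sequences (length B) e) budget ⟩
        2 ^ T * sequences (length B) (suc e) + 2 ^ T * sequences (length B) e
          ≡⟨ *-distribˡ-+ (2 ^ T) (sequences (length B) (suc e)) (sequences (length B) e) ⟨
        2 ^ T * sequences (suc (length B)) (suc e)
          ≡⟨ cong₂ (λ a e′ → 2 ^ T * sequences a e′) |A| budget ⟨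
        2 ^ T * sequences (length A) (p * suc r) ∎
        where
        open ≤-Reasoning
        open Blowup β
        y = place x (default x)
        e = length todo + p * r
        |B|≤|A| : length B ≤ length A
        |B|≤|A| = ≤-trans (n≤1+n _) (≤-reflexive (sym |A|))
        |B|≤ℓ : length B ≤ ℓ
        |B|≤ℓ = s≤s⁻¹ (≤-trans (≤-reflexive (sym |A|)) |A|≤ℓ)
        ∉todo : ∀ {u} → u ∉ todo → u ≡ x
        ∉todo {u} u∉ with u Fin.≟ x
        ... | yes u≡x = u≡x
        ... | no u≢x  = contradiction (∈-uncons all↭ (∈-allFin u) u≢x) u∉
        budget : p * suc r ≡ suc e
        budget = trans (*-suc p r)
          (cong (_+ p * r) (trans (sym (length-tabulate {n = p} id)) (↭-length all↭)))

-- Trees, tree posets and copies of posets in families.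

module TreePosets where
  import Data.Fin.Induction as Fin
  open import Data.Fin.Subset using (∣_∣; _⊆_)
  open import Data.Fin.Subset.Properties using (p⊂q⇒∣p∣<∣q∣; ⊆-antisym)
  import Data.Fin.Subset.Properties as Subset
  open import Data.List.Relation.Binary.Subset.Propositional using () renaming (_⊆_ to _⊆ˡ_)
  open import Data.List.Relation.Unary.All.Properties using (¬Any⇒All¬)
  open import Data.List.Relation.Unary.Any.Properties using (lookup-index)
  open import Data.List.Relation.Unary.Linked as Linked using (Linked; [-]; _∷_)
  open import Relation.Binary using (Rel; DecidableEquality; Symmetric)
  open import Relation.Binary.Construct.Closure.ReflexiveTransitive
    using (Star; ε; _◅_; _◅◅_; reverse)
  open import Relation.Binary.Construct.Closure.Symmetric using (fwd; bwd; symmetric)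
  open import Relation.Binary.Morphism.Structures using (IsOrderHomomorphism)
  import Relation.Binary.Properties.Poset as PosetProperties

  module _ {V : Set} (_≟_ : DecidableEquality V) {_~_ : Rel V 0ℓ} where
    open DecMembership _≟_ using (_∈?_)

    private
      suffix : ∀ {u v} ws → u ∈ ws → Unique (v ∷ ws) → Linked _~_ (ws ++ [ v ]) →
               ∃[ vs ] Unique (v ∷ u ∷ vs) × Linked _~_ (u ∷ vs ++ [ v ])
      suffix (w ∷ ws) (here refl) distinct linked = ws , distinct , linked
      suffix (w ∷ w′ ∷ ws) (there u∈) ((_ ∷ v≢) ∷ (_ ∷ distinct)) (_ ∷ linked) =
        suffix (w′ ∷ ws) u∈ (v≢ ∷ distinct) linked

    -- If u recurs on the path already found from its successor, `suffix` keeps only the part from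
    -- that recurrence on. The end v comes first in the distinctness condition to match the closed
    -- walks of `acyclic`.
    eraseLoops : ∀ {u v} → Star _~_ u v → u ≢ v →
                 ∃[ vs ] Unique (v ∷ u ∷ vs) × Linked _~_ (u ∷ vs ++ [ v ])
    eraseLoops ε u≢u = contradiction refl u≢u
    eraseLoops {u} {v} (_◅_ {j = t} u~t walk) u≢v with t ≟ v
    ... | yes refl = [] , ((u≢v ∘ sym) ∷ []) ∷ ([] ∷ []) , u~t ∷ [-]
    ... | no t≢v with vs , (v≢ ∷ distinct) , linked ← eraseLoops walk t≢v | u ∈? (t ∷ vs)
    ...   | yes u∈ = suffix (t ∷ vs) u∈ (v≢ ∷ distinct) linked
    ...   | no u∉  = t ∷ vs , ((u≢v ∘ sym) ∷ v≢) ∷ (¬Any⇒All¬ _ u∉ ∷ distinct) , u~t ∷ linked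

  Without : {V : Set} → Rel V 0ℓ → V → V → Rel V 0ℓ
  Without _~_ u v a b = a ~ b × ¬ ((a ≡ u × b ≡ v) ⊎ (a ≡ v × b ≡ u))

  -- A path from u to v avoiding the edge has an inner vertex, so the edge closes it to a cycle on
  -- at least three vertices.
  acyclic⇒bridge : {V : Set} → DecidableEquality V → {_~_ : Rel V 0ℓ} → IsTreeGraph _~_ →
                   Symmetric _~_ → ∀ {u v} → u ≢ v → u ~ v → ¬ Star (Without _~_ u v) u v
  acyclic⇒bridge _≟_ tree ~-sym {u} {v} u≢v u~v walk with eraseLoops _≟_ walk u≢v
  ... | []     , _        , (_ , avoids) ∷ _ = avoids (inj₁ (refl , refl))
  ... | w ∷ vs , distinct , linked = IsTreeGraph.acyclic tree v (u ∷ w ∷ vs) distinct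
          (s≤s (s≤s (s≤s z≤n))) (~-sym u~v ∷ Linked.map proj₁ linked)

  module _ {V : Set} {_~_ : Rel V 0ℓ} where

    walk-snoc : ∀ {m u v t} → Walk _~_ m u v → v ~ t → Walk _~_ (suc m) u t
    walk-snoc (ε , refl)     v~t = v~t ◅ ε , refl
    walk-snoc (e ◅ w , refl) v~t with w′ , eq ← walk-snoc (w , refl) v~t = e ◅ w′ , cong suc eq

    walk-unsnoc : ∀ m {u v} → Walk _~_ (suc m) u v → ∃[ t ] Walk _~_ m u t × t ~ v
    walk-unsnoc zero    (e ◅ ε , refl) = _ , (ε , refl) , e
    walk-unsnoc (suc m) (e ◅ w , eq)
      with t , (w′ , eq′) , t~v ← walk-unsnoc m (w , ℕ.suc-injective eq) =
      t , (e ◅ w′ , cong suc eq′) , t~v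

  -- Covers, and parents with respect to a root.

  module _ (P : FinPoset) where
    open FinPoset P

    private
      isSPO = PosetProperties.<-isStrictPartialOrder poset
      <-wf = Fin.spo-wellFounded isSPO
      >-wf = Fin.spo-noetherian isSPO

      -- While something lies strictly between, u moves up to it; by finiteness this stops at an
      -- element covered by v.
      lowerCover : ∀ {u v} → Fin.Acc (λ a b → b < a) u → u < v →
                   ∃[ w ] u ≤ w × Hasse poset w v
      lowerCover {u} {v} (Fin.acc rec) u<v
        with Fin.any? (λ w → (u <? w) ×-dec (w <? v))
      ... | yes (w , u<w , w<v) with t , w≤t , t⋖v ← lowerCover (rec u<w) w<v =
        t , ≤-trans (proj₁ u<w) w≤t , t⋖v
      ... | no none = u , ≤-refl , u<v , λ w between → none (w , between)

    -- The order of the blow-up is generated by its edges, so monotonicity of a map into it is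
    -- checked on covers of P.
    ≤⇒hasse* : ∀ {u v} → u ≤ v → Star (Hasse poset) u v
    ≤⇒hasse* {u} {v} = go (<-wf v)
      where
      go : ∀ {v} → Fin.Acc _<_ v → u ≤ v → Star (Hasse poset) u v
      go {v} (Fin.acc rec) u≤v with u Fin.≟ v
      ... | yes refl = ε
      ... | no u≢v with w , u≤w , w⋖v ← lowerCover (>-wf u) (u≤v , u≢v) =
        go (rec (proj₁ w⋖v)) u≤w ◅◅ (w⋖v ◅ ε)

    module Rooted (tree : IsTree P) (x : Element) where
      dist : Element → ℕ
      dist u = proj₁ (distance P tree x u)

      private
        dist-walk : ∀ u → Walk UndirectedHasse (dist u) x u
        dist-walk u = proj₁ (proj₂ (distance P tree x u))

        dist-minimal : ∀ u m → Walk UndirectedHasse m x u → dist u ℕ.≤ m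
        dist-minimal u = proj₂ (proj₂ (distance P tree x u))

      -- The last vertex but one of a shortest walk from x.
      findParent : ∀ {u} → u ≢ x → ∃[ v ] UndirectedHasse v u × dist u ≡ suc (dist v)
      findParent {u} u≢x = go (dist u) refl (dist-walk u)
        where
        go : ∀ m → dist u ≡ m → Walk UndirectedHasse m x u →
             ∃[ v ] UndirectedHasse v u × dist u ≡ suc (dist v)
        go zero    _  (ε , _) = contradiction refl u≢x
        go (suc m) eq walk with v , walk′ , v~u ← walk-unsnoc m walk =
          v , v~u , ℕ.≤-antisym
            (dist-minimal u _ (walk-snoc (dist-walk v) v~u))
            (subst (suc (dist v) ℕ.≤_) (sym eq) (s≤s (dist-minimal v m walk′)))

      -- The root has no parent; x is returned there to make the function total, and `parent-spec`
      -- excludes this case.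
      parent : Element → Element
      parent u with u Fin.≟ x
      ... | yes _  = x
      ... | no u≢x = proj₁ (findParent u≢x)

      parent-spec : ∀ {u} → u ≢ x →
                    UndirectedHasse (parent u) u × dist u ≡ suc (dist (parent u))
      parent-spec {u} u≢x with u Fin.≟ x
      ... | yes u≡x = contradiction u≡x u≢x
      ... | no u≢x′ = proj₂ (findParent u≢x′)

      ~-sym : Symmetric UndirectedHasse
      ~-sym = symmetric (Hasse poset)

      ~⇒≢ : ∀ {u v} → UndirectedHasse u v → u ≢ v
      ~⇒≢ (fwd ((_ , u≢v) , _)) = u≢v
      ~⇒≢ (bwd ((_ , v≢u) , _)) = v≢u ∘ sym

      IsParent : Element → Element → Set
      IsParent v u = u ≢ x × parent u ≡ v

      isParent? : ∀ v u → Dec (IsParent v u)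
      isParent? v u = ¬? (u Fin.≟ x) ×-dec (parent u Fin.≟ v)

      -- Otherwise u and v would remain connected through the root x without the edge uv.
      edge⇒parent : ∀ {u v} → UndirectedHasse u v → IsParent v u ⊎ IsParent u v
      edge⇒parent {u} {v} u~v with isParent? v u | isParent? u v
      ... | yes p | _     = inj₁ p
      ... | no _  | yes p = inj₂ p
      ... | no ¬p | no ¬q = contradiction (toRoot u ◅◅ reverse without-sym (toRoot v))
                              (acyclic⇒bridge Fin._≟_ tree ~-sym (~⇒≢ u~v) u~v)
        where
        R = Without UndirectedHasse u v

        without-sym : Symmetric R
        without-sym (a~b , avoids) = ~-sym a~b , λ
          { (inj₁ (b≡u , a≡v)) → avoids (inj₂ (a≡v , b≡u))
          ; (inj₂ (b≡v , a≡u)) → avoids (inj₁ (a≡u , b≡v)) }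

        -- No edge from w to its parent is the edge uv, because `¬p` and `¬q` say that neither end
        -- is the parent of the other.
        ascend : ∀ k w → dist w ℕ.≤ k → Star R w x
        ascend k w dw≤k with w Fin.≟ x
        ... | yes refl = ε
        ... | no w≢x with w~ , dw ← parent-spec w≢x with k | subst (ℕ._≤ k) dw dw≤k
        ...   | suc k | s≤s le =
          (~-sym w~ , λ { (inj₁ (refl , eq)) → ¬p (w≢x , eq)
                        ; (inj₂ (refl , eq)) → ¬q (w≢x , eq) })
          ◅ ascend k (parent w) le

        toRoot : ∀ w → Star R w x
        toRoot w = ascend (dist w) w ℕ.≤-refl

  -- Copies of posets in families

  module _ {n : ℕ} (P : FinPoset) where
    open FinPoset P

    -- Positions in F are recovered from the membership proofs, so a copy can be given by its sets.
    contains⁺ : {F : List (Subset n)} (g : Element → Subset n) → (∀ u → g u ∈ F) →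
      (∀ {u v} → u ≤ v → g u ⊆ g v) → (∀ {u v} → g u ≡ g v → u ≡ v) → Contains F poset
    contains⁺ {F} g g∈F g-mono g-injective =
      (λ u → Any.index (g∈F u)) ,
      record
        { cong = λ { refl → refl }
        ; mono = λ {u} {v} u≤v →
            subst₂ _⊆_ (lookup-index (g∈F u)) (lookup-index (g∈F v)) (g-mono u≤v)
        } ,
      λ {u} {v} eq → g-injective
        (trans (lookup-index (g∈F u)) (trans eq (sym (lookup-index (g∈F v)))))

    free-antitone : {F G : List (Subset n)} → F ⊆ˡ G → Free P G → Free P F
    free-antitone {F} F⊆G free (f , hom , injective) =
      free (contains⁺ (lookup F ∘ f) (λ u → F⊆G (∈-lookup (f u)))
              (IsOrderHomomorphism.mono hom) injective)

  unique-bounded : ∀ k {ns : List ℕ} → Unique ns → All (ℕ._< k) ns → length ns ℕ.≤ k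
  unique-bounded k {ns} distinct bounded with length ns ℕ.≤? k
  ... | yes le = le
  ... | no ≰k with i , j , i<j , eq ← Fin.pigeonhole (ℕ.≰⇒> ≰k)
                     (λ i → Fin.fromℕ< (All.lookup bounded (∈-lookup {xs = ns} i))) =
    contradiction (Fin.fromℕ<-injective _ _ _ _ eq) (apart distinct i<j)
    where
    apart : ∀ {A : Set} {xs : List A} → Unique xs → ∀ {i j} → i Fin.< j → lookup xs i ≢ lookup xs j
    apart (x≢ ∷ _)        {Fin.zero}  {Fin.suc j} _         = All.lookup x≢ (∈-lookup j)
    apart (_ ∷ distinct) {Fin.suc i} {Fin.suc j} (s≤s i<j) = apart distinct i<j

  module _ {n : ℕ} (P : FinPoset) {h k : ℕ} (height : FinPoset.IsHeight P h) where
    open FinPoset P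

    -- Distinct comparable sets differ in size, so a chain of h elements would need h sizes where
    -- only k are available.
    layers-free : ∀ m → k ℕ.< h → ∀ {F : List (Subset n)} →
                  All (λ s → m ℕ.≤ ∣ s ∣ × ∣ s ∣ ℕ.< m ℕ.+ k) F → Free P F
    layers-free m k<h {F} inLayers (f , hom , injective)
      with (us , (distinct , comparable) , refl) ← proj₁ height =
      contradiction (ℕ.≤-trans k<h (subst (ℕ._≤ k) (length-map rank us)
                      (unique-bounded k (ranks-distinct distinct comparable) (ranks-bounded us))))
                    (ℕ.<-irrefl refl)
      where
      g : Element → Subset n
      g u = lookup F (f u)

      bounds : ∀ u → m ℕ.≤ ∣ g u ∣ × ∣ g u ∣ ℕ.< m ℕ.+ k
      bounds u = All.lookup inLayers (∈-lookup (f u))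

      rank : Element → ℕ
      rank u = ∣ g u ∣ ℕ.∸ m

      ranks-bounded : ∀ us → All (ℕ._< k) (map rank us)
      ranks-bounded []       = []
      ranks-bounded (u ∷ us) =
        subst (rank u ℕ.<_) (ℕ.m+n∸m≡n m k) (ℕ.∸-monoˡ-< (proj₂ (bounds u)) (proj₁ (bounds u)))
        ∷ ranks-bounded us

      size-strict : ∀ {s t : Subset n} → s ⊆ t → s ≢ t → ∣ s ∣ ≢ ∣ t ∣
      size-strict {s} {t} s⊆t s≢t eq with Fin.any? (λ i → (i Subset.∈? t) ×-dec ¬? (i Subset.∈? s))
      ... | yes (i , i∈t , i∉s) = ℕ.<⇒≢ (p⊂q⇒∣p∣<∣q∣ (s⊆t , i , i∈t , i∉s)) eq
      ... | no none = s≢t (⊆-antisym s⊆t λ {i} i∈t → decidable-stable (i Subset.∈? s)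
                                           λ i∉s → none (i , i∈t , i∉s))

      rank-distinct : ∀ {u v} → u ≢ v → u ≤ v ⊎ v ≤ u → rank u ≢ rank v
      rank-distinct {u} {v} u≢v comparable eq = go comparable
        where
        sizes : ∣ g u ∣ ≡ ∣ g v ∣
        sizes = ℕ.∸-cancelʳ-≡ (proj₁ (bounds u)) (proj₁ (bounds v)) eq
        go : ¬ (u ≤ v ⊎ v ≤ u)
        go (inj₁ u≤v) = size-strict (IsOrderHomomorphism.mono hom u≤v) (u≢v ∘ injective) sizes
        go (inj₂ v≤u) = size-strict (IsOrderHomomorphism.mono hom v≤u) (u≢v ∘ sym ∘ injective) (sym sizes)

      ranks-distinct : ∀ {us} → Unique us → AllPairs (λ u v → u ≤ v ⊎ v ≤ u) us → Unique (map rank us)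
      ranks-distinct []                []                = []
      ranks-distinct (u≢ ∷ distinct) (u~ ∷ comparable) =
        go u≢ u~ ∷ ranks-distinct distinct comparable
        where
        go : ∀ {u vs} → All (u ≢_) vs → All (λ v → u ≤ v ⊎ v ≤ u) vs → All (rank u ≢_) (map rank vs)
        go []          []          = []
        go (u≢v ∷ ps) (u~v ∷ qs) = rank-distinct u≢v u~v ∷ go ps qs

-- Bounds for the number of free families; first the layers of the cube.

module FreeFamilies where
  open Tallies
  open TreePosets
  open import Data.Bool using (true; false)
  open import Data.Fin using (toℕ; combine)
  open import Data.Fin.Subset using (inside; outside; ∣_∣)
  open import Data.Nat using (_+_; _*_; _≤?_; _<?_)
  open import Data.Vec using (_∷_)
  open import Data.Vec.Properties using (∷-injectiveʳ)
  open import Relation.Binary.Construct.Closure.ReflexiveTransitive using (gmap)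
  open import Relation.Binary.Construct.Closure.Symmetric using (fwd)
  open import Relation.Binary.Morphism.Structures using (IsOrderHomomorphism)

  length-subsets : ∀ n → length (subsets n) ≡ 2 ^ n
  length-subsets zero    = refl
  length-subsets (suc n) = begin
    length (map (outside ∷_) (subsets n) ++ map (inside ∷_) (subsets n))
      ≡⟨ length-++ (map (outside ∷_) (subsets n)) ⟩
    length (map (outside ∷_) (subsets n)) + length (map (inside ∷_) (subsets n))
      ≡⟨ cong₂ _+_ (length-map (outside ∷_) (subsets n)) (length-map (inside ∷_) (subsets n)) ⟩
    length (subsets n) + length (subsets n)
      ≡⟨ cong₂ _+_ (length-subsets n) (trans (length-subsets n) (sym (ℕ.+-identityʳ (2 ^ n)))) ⟩
    2 ^ n + (2 ^ n + 0) ∎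
    where open ≡-Reasoning

  subsets-unique : ∀ n → Unique (subsets n)
  subsets-unique zero    = [] ∷ []
  subsets-unique (suc n) = Unique.++⁺
    (Unique.map⁺ ∷-injectiveʳ (subsets-unique n)) (Unique.map⁺ ∷-injectiveʳ (subsets-unique n))
    λ (out , ins) → disjoint out ins
    where
    disjoint : ∀ {s : Subset (suc n)} → s ∈ map (outside ∷_) (subsets n) →
               ¬ s ∈ map (inside ∷_) (subsets n)
    disjoint out ins with _ , _ , refl ← ∈-map⁻ (outside ∷_) out with ∈-map⁻ (inside ∷_) ins
    ... | _ , _ , ()

  length-filter-size : ∀ n k → length (filter (λ s → ∣ s ∣ ℕ.≟ k) (subsets n)) ≡ n C k
  length-filter-size zero    zero    = refl
  length-filter-size zero    (suc k) = refl
  length-filter-size (suc n) k = begin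
    length (filter size≟k (map (outside ∷_) (subsets n) ++ map (inside ∷_) (subsets n)))
      ≡⟨ cong length (filter-++ size≟k (map (outside ∷_) (subsets n)) _) ⟩
    length (filter size≟k (map (outside ∷_) (subsets n)) ++ filter size≟k (map (inside ∷_) (subsets n)))
      ≡⟨ length-++ (filter size≟k (map (outside ∷_) (subsets n))) ⟩
    length (filter size≟k (map (outside ∷_) (subsets n))) +
    length (filter size≟k (map (inside ∷_) (subsets n)))
      ≡⟨ cong₂ _+_ (length-filter-map size≟k (outside ∷_) (subsets n))
                   (length-filter-map size≟k (inside ∷_) (subsets n)) ⟩
    length (filter (λ s → ∣ s ∣ ℕ.≟ k) (subsets n)) +
    length (filter (λ s → suc ∣ s ∣ ℕ.≟ k) (subsets n))
      ≡⟨ cong₂ _+_ (length-filter-size n k) refl ⟩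
    n C k + length (filter (λ s → suc ∣ s ∣ ℕ.≟ k) (subsets n))
      ≡⟨ pascal k ⟩
    suc n C k ∎
    where
    open ≡-Reasoning
    size≟k : (s : Subset (suc n)) → Dec (∣ s ∣ ≡ k)
    size≟k s = ∣ s ∣ ℕ.≟ k

    none : ∀ (ss : List (Subset n)) → length (filter (λ s → suc ∣ s ∣ ℕ.≟ 0) ss) ≡ 0
    none []       = refl
    none (s ∷ ss) = none ss

    shifted : ∀ k (ss : List (Subset n)) → length (filter (λ s → suc ∣ s ∣ ℕ.≟ suc k) ss) ≡
                                    length (filter (λ s → ∣ s ∣ ℕ.≟ k) ss)
    shifted k []       = refl
    shifted k (s ∷ ss) with ∣ s ∣ ℕ.≡ᵇ k
    ... | true  = cong suc (shifted k ss)
    ... | false = shifted k ss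

    pascal : ∀ k → n C k + length (filter (λ s → suc ∣ s ∣ ℕ.≟ k) (subsets n)) ≡ suc n C k
    pascal zero    = cong₂ _+_ (refl {x = 1}) (none (subsets n))
    pascal (suc k) = begin
      n C suc k + length (filter (λ s → suc ∣ s ∣ ℕ.≟ suc k) (subsets n))
        ≡⟨ cong (n C suc k +_) (trans (shifted k (subsets n)) (length-filter-size n k)) ⟩
      n C suc k + n C k ≡⟨ ℕ.+-comm (n C suc k) (n C k) ⟩
      n C k + n C suc k ≡⟨ nCk+nC[k+1]≡[n+1]C[k+1] n k ⟩
      suc n C suc k     ∎

  filter-disjoint : {X : Set} {P Q R : Pred X 0ℓ}
    (P? : Decidable P) (Q? : Decidable Q) (R? : Decidable R) →
    (∀ {x} → P x → ¬ Q x) → (∀ {x} → P x → R x) → (∀ {x} → Q x → R x) →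
    ∀ xs → length (filter P? xs) + length (filter Q? xs) ℕ.≤ length (filter R? xs)
  filter-disjoint P? Q? R? disjoint P⇒R Q⇒R [] = ℕ.z≤n
  filter-disjoint P? Q? R? disjoint P⇒R Q⇒R (x ∷ xs)
    with ih ← filter-disjoint P? Q? R? disjoint P⇒R Q⇒R xs | P? x | Q? x | R? x
  ... | yes p | yes q | _     = contradiction q (disjoint p)
  ... | yes p | no _  | yes _ = ℕ.s≤s ih
  ... | yes p | no _  | no ¬r = contradiction (P⇒R p) ¬r
  ... | no _  | yes q | yes _ = ℕ.≤-trans (ℕ.≤-reflexive (ℕ.+-suc _ _)) (ℕ.s≤s ih)
  ... | no _  | yes q | no ¬r = contradiction (Q⇒R q) ¬r
  ... | no _  | no _  | yes _ = ℕ.m≤n⇒m≤1+n ih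
  ... | no _  | no _  | no _  = ih

  layer? : ∀ {n} m k (s : Subset n) → Dec (m ℕ.≤ ∣ s ∣ × ∣ s ∣ ℕ.< m + k)
  layer? m k s = (m ≤? ∣ s ∣) ×-dec (∣ s ∣ <? m + k)

  binomialSum : ℕ → ℕ → ℕ → ℕ
  binomialSum n m zero    = 0
  binomialSum n m (suc k) = binomialSum n m k + n C (m + k)

  binomialSum≤layers : ∀ n m k → binomialSum n m k ℕ.≤ length (filter (layer? m k) (subsets n))
  binomialSum≤layers n m zero    = ℕ.z≤n
  binomialSum≤layers n m (suc k) = begin
    binomialSum n m k + n C (m + k)
      ≤⟨ ℕ.+-mono-≤ (binomialSum≤layers n m k) (ℕ.≤-reflexive (sym (length-filter-size n (m + k)))) ⟩
    length (filter (layer? m k) (subsets n)) + length (filter (λ s → ∣ s ∣ ℕ.≟ m + k) (subsets n))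
      ≤⟨ filter-disjoint (layer? m k) (λ s → ∣ s ∣ ℕ.≟ m + k) (layer? m (suc k))
           (λ (_ , <) eq → ℕ.<⇒≢ < eq)
           (λ (≥ , <) → ≥ , ℕ.<-≤-trans < (ℕ.+-monoʳ-≤ m (ℕ.n≤1+n k)))
           (λ eq → ℕ.≤-trans (ℕ.m≤m+n m k) (ℕ.≤-reflexive (sym eq)) ,
                   ℕ.≤-reflexive (trans (cong suc eq) (sym (ℕ.+-suc m k))))
           (subsets n) ⟩
    length (filter (layer? m (suc k)) (subsets n)) ∎
    where open ℕ.≤-Reasoning

  numberOfFree-lower : ∀ (P : FinPoset) {h k} → FinPoset.IsHeight P h → k ℕ.< h → ∀ n m →
                       2 ^ binomialSum n m k ℕ.≤ numberOfFree P n
  numberOfFree-lower P {k = k} height k<h n m = begin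
    2 ^ binomialSum n m k
      ≤⟨ ℕ.^-monoʳ-≤ 2 (binomialSum≤layers n m k) ⟩
    2 ^ length (filter (layer? m k) (subsets n))
      ≤⟨ 2^≤tally (layer? m k) (λ F inLayers → indicator-true (free? P F)
                    (layers-free P height m k<h inLayers)) (subsets n) ⟩
    tally (indicator ∘ free? P) (subsets n)
      ≡⟨ length-filter-sublists (free? P) (subsets n) ⟨
    numberOfFree P n ∎
    where open ℕ.≤-Reasoning

  -- The search applied to blow-ups of a tree poset.

  module _ (P : FinPoset) (tree : IsTree P) (x : FinPoset.Element P) (d : ℕ) .{{_ : NonZero d}} where
    open FinPoset P
    open Rooted P tree x
    private
      module B = BlowUp P tree x d

      InBlock : ∀ u → Fin (d ^ dist u) → Fin (d ^ dist (parent u)) → Set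
      InBlock u i j = ∃[ r ] toℕ i ≡ toℕ j * d + toℕ {d} r

      -- `combine j t` has index d j + t, as the blow-up requires. The cast bridges
      -- `d ^ dist (parent u) * d` and `d ^ dist u`, whose equality rests on `parent-spec`.
      block : ∀ {u} → u ≢ x → (j : Fin (d ^ dist (parent u))) →
        Σ[ f ∈ (Fin d → Fin (d ^ dist u)) ]
          (∀ {s t} → f s ≡ f t → s ≡ t) × (∀ t → InBlock u (f t) j)
      block {u} u≢x j = f , f-injective ,
        λ t → t , trans (Fin.toℕ-cast total (combine j t))
                    (trans (Fin.toℕ-combine j t) (cong (_+ toℕ t) (ℕ.*-comm d (toℕ j))))
        where
        total : d ^ dist (parent u) * d ≡ d ^ dist u
        total = trans (ℕ.*-comm (d ^ dist (parent u)) d) (cong (d ^_) (sym (proj₂ (parent-spec u≢x))))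
        f : Fin d → Fin (d ^ dist u)
        f t = Fin.cast total (combine j t)
        f-injective : ∀ {s t} → f s ≡ f t → s ≡ t
        f-injective {s} {t} eq = Fin.combine-injectiveʳ j s j t (Fin.toℕ-injective
          (trans (sym (Fin.toℕ-cast total (combine j s)))
                 (trans (cong toℕ eq) (Fin.toℕ-cast total (combine j t)))))

      -- For the root this is its single copy; for other vertices it is a placeholder until the
      -- search finds a copy.
      default : ∀ u → Fin (d ^ dist u)
      default u = Fin.fromℕ< (ℕ.m^n>0 d (dist u))

    module _ (n : ℕ) where
      private
        weight : List (Subset n) → ℕ
        weight = indicator ∘ free? P

        module S = Search {X = Subset n} x parent dist (λ u≢x → proj₂ (parent-spec u≢x))
          (λ u → Fin (d ^ dist u)) default d InBlock block weight
          (λ {F} {G} F⊆G → indicator-mono (free? P G) (free? P F) (free-antitone P F⊆G))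
          (λ F → indicator≤1 (free? P F))

      -- By `edge⇒parent`, every cover of P joins a vertex to its parent, so a consistent choice of
      -- copies sends covers to edges of the blow-up.
      contains⇒blowup : ∀ {F} → Contains F (blowUp P tree x d) → S.Blowup F
      contains⇒blowup {F} (f , hom , injective) = record
        { place           = place
        ; place∈          = λ u i → ∈-lookup (f (u , i))
        ; place-injective = injective
        ; kills           = λ idx consistent S chosen → indicator-false (free? P S) λ free →
            free (contains⁺ P (λ u → place u (idx u)) chosen
                    (λ u≤v → IsOrderHomomorphism.mono hom
                       (gmap (λ u → u , idx u) (lift idx consistent) (≤⇒hasse* P u≤v)))
                    (cong proj₁ ∘ injective))
        }
        where
        place : ∀ u → Fin (d ^ dist u) → Subset n
        place u i = lookup F (f (u , i))

        lift : ∀ idx → S.Consistent idx → ∀ {u v} → Hasse poset u v → B.Edge (u , idx u) (v , idx v)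
        lift idx consistent {u} {v} u⋖v with edge⇒parent (fwd u⋖v)
        ... | inj₁ (u≢x , refl) = u⋖v , inj₁ (proj₂ (parent-spec u≢x) , consistent u u≢x)
        ... | inj₂ (v≢x , refl) = u⋖v , inj₂ (proj₂ (parent-spec v≢x) , consistent v v≢x)

      numberOfFree-upper : ∀ T r → 2 ^ n ℕ.≤ d * r →
        (∀ F → Unique F → T ℕ.< length F → Contains F (blowUp P tree x d)) →
        numberOfFree P n ℕ.≤ 2 ^ T * sequences (2 ^ n) (size * r)
      numberOfFree-upper T r 2^n≤ contains = begin
        numberOfFree P n
          ≡⟨ length-filter-sublists (free? P) (subsets n) ⟩
        tally weight (subsets n)
          ≤⟨ S.tally-bound T (λ F F! T< → contains⇒blowup (contains F F! T<)) r (subsets n)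
               (subsets-unique n) (ℕ.≤-trans (ℕ.≤-reflexive (length-subsets n)) 2^n≤) ⟩
        2 ^ T * sequences (length (subsets n)) (size * r)
          ≡⟨ cong (λ a → 2 ^ T * sequences a (size * r)) (length-subsets n) ⟩
        2 ^ T * sequences (2 ^ n) (size * r) ∎
        where open ℕ.≤-Reasoning

-- Numerical estimates; first the central binomial coefficient.

module Estimates where
  open Tallies using (sequences; sequences-bound)
  open FreeFamilies using (binomialSum)
  open import Data.Nat
  open import Data.Nat.Properties
  open import Data.Nat.Tactic.RingSolver using (solve-∀)

  -- This is (k + 1) C(n, k + 1) = (n - k) C(n, k) without the subtraction, proved by Pascal's rule.
  C-recurrence : ∀ n k → suc k * (n C suc k) + k * (n C k) ≡ n * (n C k)
  C-recurrence zero    zero    = refl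
  C-recurrence zero    (suc k) = cong₂ _+_ (*-zeroʳ k) (*-zeroʳ k)
  C-recurrence (suc n) zero    = begin
    suc n C 1 + 0 + 0 ≡⟨ trans (+-identityʳ _) (+-identityʳ _) ⟩
    suc n C 1         ≡⟨ nC1≡n (suc n) ⟩
    suc n             ≡⟨ *-identityʳ (suc n) ⟨
    suc n * 1         ∎
    where open ≡-Reasoning
  C-recurrence (suc n) (suc k) = begin
    (2 + k) * (suc n C (2 + k)) + suc k * (suc n C suc k)
      ≡⟨ cong₂ (λ b a → (2 + k) * b + suc k * a) (nCk+nC[k+1]≡[n+1]C[k+1] n (suc k))
                                                 (nCk+nC[k+1]≡[n+1]C[k+1] n k) ⟨
    (2 + k) * (b + c) + suc k * (a + b)
      ≡⟨ lemma k a b c ⟩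
    ((2 + k) * c + suc k * b) + (suc k * b + k * a) + (a + b)
      ≡⟨ cong₂ (λ y z → y + z + (a + b)) (C-recurrence n (suc k)) (C-recurrence n k) ⟩
    n * b + n * a + (a + b)
      ≡⟨ lemma′ n a b ⟩
    suc n * (a + b)
      ≡⟨ cong (suc n *_) (nCk+nC[k+1]≡[n+1]C[k+1] n k) ⟩
    suc n * (suc n C suc k) ∎
    where
    open ≡-Reasoning
    a = n C k
    b = n C suc k
    c = n C (2 + k)
    lemma : ∀ k a b c → (2 + k) * (b + c) + suc k * (a + b) ≡
                        ((2 + k) * c + suc k * b) + (suc k * b + k * a) + (a + b)
    lemma = solve-∀
    lemma′ : ∀ n a b → n * b + n * a + (a + b) ≡ suc n * (a + b)
    lemma′ = solve-∀

  oddCentral-symmetric : ∀ m → suc (m + m) C m ≡ suc (m + m) C suc m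
  oddCentral-symmetric m = begin
    suc (m + m) C m                 ≡⟨ nCk≡nC[n∸k] (m≤n⇒m≤1+n (m≤m+n m m)) ⟩
    suc (m + m) C (suc (m + m) ∸ m) ≡⟨ cong (suc (m + m) C_) (trans (cong (_∸ m) (sym (+-suc m m))) (m+n∸m≡n m (suc m))) ⟩
    suc (m + m) C suc m             ∎
    where open ≡-Reasoning

  central-suc : ∀ m → (suc m + suc m) C suc m ≡ 2 * (suc (m + m) C m)
  central-suc m = begin
    (suc m + suc m) C suc m                 ≡⟨ cong (λ k → suc k C suc m) (+-suc m m) ⟩
    suc (suc (m + m)) C suc m               ≡⟨ nCk+nC[k+1]≡[n+1]C[k+1] (suc (m + m)) m ⟨
    suc (m + m) C m + suc (m + m) C suc m   ≡⟨ cong (suc (m + m) C m +_) (oddCentral-symmetric m) ⟨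
    suc (m + m) C m + suc (m + m) C m       ≡⟨ cong (suc (m + m) C m +_) (+-identityʳ _) ⟨
    2 * (suc (m + m) C m)                   ∎
    where open ≡-Reasoning

  central-ratio : ∀ m → suc m * ((suc m + suc m) C suc m) ≡ 2 * (suc (m + m) * ((m + m) C m))
  central-ratio m = begin
    suc m * ((suc m + suc m) C suc m)      ≡⟨ cong (suc m *_) (trans (central-suc m) (cong (2 *_) (oddCentral-symmetric m))) ⟩
    suc m * (2 * (suc (m + m) C suc m))    ≡⟨ cong (λ y → suc m * (2 * y)) (nCk+nC[k+1]≡[n+1]C[k+1] (m + m) m) ⟨
    suc m * (2 * (c + e))                  ≡⟨ lemma m c e ⟩
    2 * ((suc m * e + m * c) + c)          ≡⟨ cong (λ y → 2 * (y + c)) (C-recurrence (m + m) m) ⟩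
    2 * ((m + m) * c + c)                  ≡⟨ cong (2 *_) (+-comm ((m + m) * c) c) ⟩
    2 * (suc (m + m) * c) ∎
    where
    open ≡-Reasoning
    c = (m + m) C m
    e = (m + m) C suc m
    lemma : ∀ m c e → suc m * (2 * (c + e)) ≡ 2 * ((suc m * e + m * c) + c)
    lemma = solve-∀

  -- The factor 4m + 1 makes the induction work: (4m + 5)(2m + 1)² = 4(4m + 1)(m + 1)² + 1.
  central-lower : ∀ m → 16 ^ m ≤ ((m + m) C m) * ((m + m) C m) * suc (4 * m)
  central-lower zero    = ≤-refl
  central-lower (suc m) = *-cancelʳ-≤ (16 ^ suc m) (c′ * c′ * suc (4 * suc m)) (suc m * suc m) (begin
    16 * 16 ^ m * (suc m * suc m)
      ≤⟨ *-monoˡ-≤ (suc m * suc m) (*-monoʳ-≤ 16 (central-lower m)) ⟩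
    16 * (c * c * suc (4 * m)) * (suc m * suc m)
      -- The added term is 4c² times the surplus 1 in the identity above.
      ≤⟨ m≤m+n _ (4 * (c * c)) ⟩
    16 * (c * c * suc (4 * m)) * (suc m * suc m) + 4 * (c * c)
      ≡⟨ lemma m c ⟩
    2 * (suc (m + m) * c) * (2 * (suc (m + m) * c)) * suc (4 * suc m)
      ≡⟨ cong (λ y → y * y * suc (4 * suc m)) (central-ratio m) ⟨
    suc m * c′ * (suc m * c′) * suc (4 * suc m)
      ≡⟨ lemma′ m c′ ⟩
    c′ * c′ * suc (4 * suc m) * (suc m * suc m) ∎)
    where
    open ≤-Reasoning
    c  = (m + m) C m
    c′ = (suc m + suc m) C suc m
    lemma : ∀ m c → 16 * (c * c * suc (4 * m)) * (suc m * suc m) + 4 * (c * c) ≡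
                    2 * (suc (m + m) * c) * (2 * (suc (m + m) * c)) * suc (4 * suc m)
    lemma = solve-∀
    lemma′ : ∀ m c′ → suc m * c′ * (suc m * c′) * suc (4 * suc m) ≡
                      c′ * c′ * suc (4 * suc m) * (suc m * suc m)
    lemma′ = solve-∀

  *-^-distrib : ∀ k a b → (a * b) ^ k ≡ a ^ k * b ^ k
  *-^-distrib zero    a b = refl
  *-^-distrib (suc k) a b = trans (cong (a * b *_) (*-^-distrib k a b)) (lemma a b (a ^ k) (b ^ k))
    where
    lemma : ∀ a b c d → a * b * (c * d) ≡ a * c * (b * d)
    lemma = solve-∀

  halves : ∀ n → n ≡ ⌊ n /2⌋ + ⌊ n /2⌋ ⊎ n ≡ suc (⌊ n /2⌋ + ⌊ n /2⌋)
  halves zero          = inj₁ refl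
  halves (suc zero)    = inj₂ refl
  halves (suc (suc n)) with halves n
  ... | inj₁ eq = inj₁ (cong suc (trans (cong suc eq) (sym (+-suc ⌊ n /2⌋ ⌊ n /2⌋))))
  ... | inj₂ eq = inj₂ (cong suc (cong suc (trans eq (sym (+-suc ⌊ n /2⌋ ⌊ n /2⌋)))))

  2^-double : ∀ m → 2 ^ (m + m) * 2 ^ (m + m) ≡ 16 ^ m
  2^-double m = begin
    2 ^ (m + m) * 2 ^ (m + m) ≡⟨ ^-distribˡ-+-* 2 (m + m) (m + m) ⟨
    2 ^ ((m + m) + (m + m))   ≡⟨ cong (2 ^_) (lemma m) ⟩
    2 ^ (4 * m)               ≡⟨ ^-*-assoc 2 4 m ⟨
    16 ^ m                    ∎
    where
    open ≡-Reasoning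
    lemma : ∀ m → (m + m) + (m + m) ≡ 4 * m
    lemma = solve-∀

  central : ℕ → ℕ
  central n = n C ⌊ n /2⌋

  -- The squared form of `central n` ≥ 2^n / √(2n + 3). An odd n is reduced to n + 1, whose central
  -- coefficient is twice as large.
  central-square : ∀ n → 2 ^ n * 2 ^ n ≤ central n * central n * (2 * n + 3)
  central-square n with ⌊ n /2⌋ | halves n
  ... | m | inj₁ refl = begin
    2 ^ (m + m) * 2 ^ (m + m) ≡⟨ 2^-double m ⟩
    16 ^ m                    ≤⟨ central-lower m ⟩
    c * c * suc (4 * m)       ≤⟨ *-monoʳ-≤ (c * c) (≤-trans (m≤m+n _ 2) (≤-reflexive (lemma m))) ⟩
    c * c * (2 * (m + m) + 3) ∎
    where
    open ≤-Reasoning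
    c = (m + m) C m
    lemma : ∀ m → suc (4 * m) + 2 ≡ 2 * (m + m) + 3
    lemma = solve-∀
  ... | m | inj₂ refl = *-cancelˡ-≤ 4 (begin
    4 * (2 * 2 ^ (m + m) * (2 * 2 ^ (m + m))) ≡⟨ lemma (2 ^ (m + m)) ⟩
    16 * (2 ^ (m + m) * 2 ^ (m + m))          ≡⟨ cong (16 *_) (2^-double m) ⟩
    16 ^ suc m                                ≤⟨ central-lower (suc m) ⟩
    c′ * c′ * suc (4 * suc m)                 ≡⟨ cong (λ y → y * y * suc (4 * suc m)) (central-suc m) ⟩
    2 * c * (2 * c) * suc (4 * suc m)         ≡⟨ lemma′ m c ⟩
    4 * (c * c * (2 * suc (m + m) + 3))       ∎)
    where
    open ≤-Reasoning
    c  = suc (m + m) C m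
    c′ = (suc m + suc m) C suc m
    lemma : ∀ y → 4 * (2 * y * (2 * y)) ≡ 16 * (y * y)
    lemma = solve-∀
    lemma′ : ∀ m c → 2 * c * (2 * c) * suc (4 * suc m) ≡ 4 * (c * c * (2 * suc (m + m) + 3))
    lemma′ = solve-∀

  square-cancel-≤ : ∀ {a b} → a * a ≤ b * b → a ≤ b
  square-cancel-≤ {a} {b} a²≤b² with a ≤? b
  ... | yes a≤b = a≤b
  ... | no a≰b  = contradiction (≤-trans (*-mono-< (≰⇒> a≰b) (≰⇒> a≰b)) a²≤b²) (<-irrefl refl)

  -- The hypothesis makes `4 * 2 ^ j` at least √(2n + 3), trading the square root for a power of
  -- two.
  2^≤central : ∀ n j → n < 4 ^ suc j → 2 ^ n ≤ central n * (4 * 2 ^ j)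
  2^≤central n j n< = square-cancel-≤ (begin
    2 ^ n * 2 ^ n                               ≤⟨ central-square n ⟩
    central n * central n * (2 * n + 3)         ≤⟨ *-monoʳ-≤ (central n * central n) bound ⟩
    central n * central n * (16 * (2 ^ j * 2 ^ j)) ≡⟨ lemma (central n) (2 ^ j) ⟩
    central n * (4 * 2 ^ j) * (central n * (4 * 2 ^ j)) ∎)
    where
    open ≤-Reasoning
    lemma : ∀ c y → c * c * (16 * (y * y)) ≡ c * (4 * y) * (c * (4 * y))
    lemma = solve-∀
    lemma₂ : ∀ n → 2 * n + 3 ≡ 2 * suc n + 1
    lemma₂ = solve-∀
    lemma₃ : ∀ y → 2 * (4 * y) + 8 * y ≡ 16 * y
    lemma₃ = solve-∀
    bound : 2 * n + 3 ≤ 16 * (2 ^ j * 2 ^ j)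
    bound = begin
      2 * n + 3             ≡⟨ lemma₂ n ⟩
      2 * suc n + 1         ≤⟨ +-mono-≤ (*-monoʳ-≤ 2 n<) (≤-trans (m^n>0 4 j) (m≤m+n (4 ^ j) (7 * 4 ^ j))) ⟩
      2 * (4 * 4 ^ j) + 8 * 4 ^ j ≡⟨ lemma₃ (4 ^ j) ⟩
      16 * 4 ^ j            ≡⟨ cong (16 *_) (*-^-distrib j 2 2) ⟩
      16 * (2 ^ j * 2 ^ j)  ∎

  -- Layers near the middle

  module _ (n : ℕ) where
    private
      m = ⌊ n /2⌋

      2m≤n : m + m ≤ n
      2m≤n with halves n
      ... | inj₁ eq = ≤-reflexive (sym eq)
      ... | inj₂ eq = ≤-trans (n≤1+n _) (≤-reflexive (sym eq))

      n≤1+2m : n ≤ suc (m + m)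
      n≤1+2m with halves n
      ... | inj₁ eq = ≤-trans (≤-reflexive eq) (n≤1+n _)
      ... | inj₂ eq = ≤-reflexive eq

    C-descends : ∀ j → n C suc (m + j) ≤ n C (m + j)
    C-descends j = *-cancelˡ-≤ (suc (m + j)) (+-cancelʳ-≤ ((m + j) * a) _ _ (begin
      suc (m + j) * b + (m + j) * a   ≡⟨ C-recurrence n (m + j) ⟩
      n * a                           ≤⟨ *-monoˡ-≤ a (≤-trans n≤1+2m (s≤s (+-mono-≤ (m≤m+n m j) (m≤m+n m j)))) ⟩
      (suc (m + j) + (m + j)) * a     ≡⟨ *-distribʳ-+ a (suc (m + j)) (m + j) ⟩
      suc (m + j) * a + (m + j) * a   ∎))
      where
      open ≤-Reasoning
      a = n C (m + j)
      b = n C suc (m + j)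

    C≤central : ∀ j → n C (m + j) ≤ central n
    C≤central zero    = ≤-reflexive (cong (n C_) (+-identityʳ m))
    C≤central (suc j) = ≤-trans (≤-reflexive (cong (n C_) (+-suc m j))) (≤-trans (C-descends j) (C≤central j))

    -- That is, C(n, m + j) ≥ (1 - j²/m) `central n`. Passing from j to j + 1 loses at most (2j +
    -- 1)/m of `central n`, and these odd numbers add up to squares.
    C-near-middle : ∀ j → m * central n ≤ m * (n C (m + j)) + j * j * central n
    C-near-middle zero    = ≤-reflexive (trans (cong (λ k → m * (n C k)) (sym (+-identityʳ m))) (sym (+-identityʳ _)))
    C-near-middle (suc j) = begin
      m * M                          ≤⟨ C-near-middle j ⟩
      m * a + j * j * M              ≤⟨ +-monoˡ-≤ (j * j * M) step ⟩
      m * b + suc (j + j) * M + j * j * M ≡⟨ lemma m b j M ⟩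
      m * b + suc j * suc j * M      ≡⟨ cong (λ k → m * (n C k) + suc j * suc j * M) (+-suc m j) ⟨
      m * (n C (m + suc j)) + suc j * suc j * M ∎
      where
      open ≤-Reasoning
      M = central n
      a = n C (m + j)
      b = n C suc (m + j)
      lemma : ∀ m b j M → m * b + suc (j + j) * M + j * j * M ≡ m * b + suc j * suc j * M
      lemma = solve-∀
      lemma₁ : ∀ m j a b → m * a + (m + j) * a ≡ (m + m) * a + j * a
      lemma₁ = solve-∀
      lemma₂ : ∀ m j a b → suc (m + j) * b + (m + j) * a + j * a ≡ m * b + (suc j * b + j * a) + (m + j) * a
      lemma₂ = solve-∀
      b≤M : b ≤ M
      b≤M = ≤-trans (C-descends j) (C≤central j)
      step : m * a ≤ m * b + suc (j + j) * M
      step = +-cancelʳ-≤ ((m + j) * a) _ _ (begin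
        m * a + (m + j) * a                         ≡⟨ lemma₁ m j a b ⟩
        (m + m) * a + j * a                         ≤⟨ +-monoˡ-≤ (j * a) (*-monoˡ-≤ a 2m≤n) ⟩
        n * a + j * a                               ≡⟨ cong (_+ j * a) (C-recurrence n (m + j)) ⟨
        suc (m + j) * b + (m + j) * a + j * a       ≡⟨ lemma₂ m j a b ⟩
        m * b + (suc j * b + j * a) + (m + j) * a
          ≤⟨ +-monoˡ-≤ ((m + j) * a) (+-monoʳ-≤ (m * b)
               (+-mono-≤ (*-monoʳ-≤ (suc j) b≤M) (*-monoʳ-≤ j (C≤central j)))) ⟩
        m * b + (suc j * M + j * M) + (m + j) * a
          ≡⟨ cong (λ y → m * b + y + (m + j) * a) (*-distribʳ-+ M (suc j) j) ⟨
        m * b + suc (j + j) * M + (m + j) * a ∎)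

    binomialSum-lower : ∀ k → m * (k * central n) ≤ m * binomialSum n m k + k * k * k * central n
    binomialSum-lower zero    = ≤-reflexive (sym (+-identityʳ _))
    binomialSum-lower (suc k) = begin
      m * (M + k * M)                         ≡⟨ *-distribˡ-+ m M (k * M) ⟩
      m * M + m * (k * M)                     ≤⟨ +-mono-≤ (C-near-middle k) (binomialSum-lower k) ⟩
      -- The added coefficient is (k + 1)³ - k³ - k²: cubes crudely bound the sums of squares.
      (m * a + k * k * M) + (m * s + k * k * k * M) ≤⟨ m≤m+n _ ((2 * (k * k) + 3 * k + 1) * M) ⟩
      (m * a + k * k * M) + (m * s + k * k * k * M) + (2 * (k * k) + 3 * k + 1) * M ≡⟨ lemma m a k M s ⟩
      m * (s + a) + suc k * suc k * suc k * M ∎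
      where
      open ≤-Reasoning
      M = central n
      a = n C (m + k)
      s = binomialSum n m k
      lemma : ∀ m a k M s → (m * a + k * k * M) + (m * s + k * k * k * M) + (2 * (k * k) + 3 * k + 1) * M ≡
                            m * (s + a) + suc k * suc k * suc k * M
      lemma = solve-∀

  -- Sizes of the exponents

  -- Bernoulli's inequality (1 - 1/(y + 1))^j ≥ 1 - j/(y + 1), cleared of denominators.
  bernoulli : ∀ y j → suc y ^ j * suc y ≤ y ^ j * suc y + j * suc y ^ j
  bernoulli y zero    = ≤-reflexive (sym (+-identityʳ _))
  bernoulli y (suc j) = begin
    suc y * suc y ^ j * suc y                        ≡⟨ *-assoc (suc y) (suc y ^ j) (suc y) ⟩
    suc y * (suc y ^ j * suc y)                      ≤⟨ *-monoʳ-≤ (suc y) (bernoulli y j) ⟩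
    suc y * (y ^ j * suc y + j * suc y ^ j)          ≡⟨ lemma y (y ^ j) j (suc y ^ j) ⟩
    y * y ^ j * suc y + (y ^ j * suc y + j * (suc y * suc y ^ j))
      ≤⟨ +-monoʳ-≤ (y * y ^ j * suc y) (+-monoˡ-≤ (j * (suc y * suc y ^ j))
           (≤-trans (*-monoˡ-≤ (suc y) (^-monoˡ-≤ j (n≤1+n y))) (≤-reflexive (*-comm (suc y ^ j) (suc y))))) ⟩
    y * y ^ j * suc y + suc j * suc y ^ suc j ∎
    where
    open ≤-Reasoning
    lemma : ∀ y a j b → suc y * (a * suc y + j * b) ≡ y * a * suc y + (a * suc y + j * (suc y * b))
    lemma = solve-∀

  -- That is, (1 − 1/2m)^m ≥ 1/2.
  half-bernoulli : ∀ q m .{{_ : NonZero m}} → suc q ≡ 2 * m → suc q ^ m ≤ 2 * q ^ m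
  half-bernoulli q m eq = *-cancelˡ-≤ m (+-cancelʳ-≤ (m * b) _ _ (begin
    m * b + m * b       ≡⟨ lemma m b ⟩
    b * (2 * m)         ≡⟨ cong (b *_) eq ⟨
    b * suc q           ≤⟨ bernoulli q m ⟩
    a * suc q + m * b   ≡⟨ cong (λ y → a * y + m * b) eq ⟩
    a * (2 * m) + m * b ≡⟨ lemma′ m a b ⟩
    m * (2 * a) + m * b ∎))
    where
    open ≤-Reasoning
    a = q ^ m
    b = suc q ^ m
    lemma : ∀ m b → m * b + m * b ≡ b * (2 * m)
    lemma = solve-∀
    lemma′ : ∀ m a b → a * (2 * m) + m * b ≡ m * (2 * a) + m * b
    lemma′ = solve-∀

  -- Take q = 2m - 1 with m = 2^k in `sequences-bound`: then ((q + 1)/q)^(ms) ≤ 2^s by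
  -- `half-bernoulli`, and q^e ≤ (2m)^e = 2^((k + 1)e).
  sequences≤2^ : ∀ k s e → sequences (2 ^ k * s) e ≤ 2 ^ (s + suc k * e)
  sequences≤2^ k s e with 2 ^ k in eqₘ
  ... | zero  = contradiction (sym eqₘ) (<⇒≢ (m^n>0 2 k))
  ... | suc l = *-cancelʳ-≤ (sequences (m * s) e) (2 ^ (s + suc k * e)) (q ^ (m * s)) {{m^n≢0 q (m * s)}} (begin
    sequences (m * s) e * q ^ (m * s) ≤⟨ sequences-bound q (m * s) e ⟩
    suc q ^ (m * s) * q ^ e           ≡⟨ cong (_* q ^ e) (^-*-assoc (suc q) m s) ⟨
    (suc q ^ m) ^ s * q ^ e           ≤⟨ *-mono-≤ (^-monoˡ-≤ s (half-bernoulli q m 1+q)) (^-monoˡ-≤ e (n≤1+n q)) ⟩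
    (2 * q ^ m) ^ s * suc q ^ e       ≡⟨ cong₂ _*_ (*-^-distrib s 2 (q ^ m)) (cong (_^ e) (trans 1+q (cong (2 *_) (sym eqₘ)))) ⟩
    2 ^ s * (q ^ m) ^ s * (2 ^ suc k) ^ e ≡⟨ cong₂ (λ y z → 2 ^ s * y * z) (^-*-assoc q m s) (^-*-assoc 2 (suc k) e) ⟩
    2 ^ s * q ^ (m * s) * 2 ^ (suc k * e) ≡⟨ *-CS.xy∙z≈xz∙y (2 ^ s) (q ^ (m * s)) (2 ^ (suc k * e)) ⟩
    2 ^ s * 2 ^ (suc k * e) * q ^ (m * s) ≡⟨ cong (_* q ^ (m * s)) (^-distribˡ-+-* 2 s (suc k * e)) ⟨
    2 ^ (s + suc k * e) * q ^ (m * s) ∎)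
    where
    open ≤-Reasoning
    m = suc l
    q = suc (l + l)
    1+q : suc q ≡ 2 * m
    1+q = lemma l
      where
      lemma : ∀ l → suc (suc (l + l)) ≡ 2 * suc l
      lemma = solve-∀

  n<2^n : ∀ n → n < 2 ^ n
  n<2^n zero    = ≤-refl
  n<2^n (suc n) = +-mono-≤ (m^n>0 2 n) (≤-trans (n<2^n n) (m≤m+n _ 0))

  linear≤2^ : ∀ c → ∃[ j₀ ] ∀ j → j₀ ≤ j → c * suc (2 * j) ≤ 2 ^ j
  linear≤2^ c = j₀ , λ j j₀≤j → subst (λ j → c * suc (2 * j) ≤ 2 ^ j) (m+[n∸m]≡n j₀≤j) (go (j ∸ j₀))
    where
    open ≤-Reasoning
    -- Chosen so that 2^j₀ = 2^c · 8 · 2^(2c): the first factor exceeds c, the others cover 2j₀ + 1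
    -- = 6c + 7.
    j₀ = c + (3 + 2 * c)

    base : c * suc (2 * j₀) ≤ 2 ^ j₀
    base = begin
      c * suc (2 * j₀)              ≤⟨ *-mono-≤ (≤-trans (n≤1+n c) (n<2^n c)) (begin
        suc (2 * j₀)                 ≡⟨ lemma c ⟩
        6 * c + 7                    ≤⟨ m≤m+n _ (2 * c + 1) ⟩
        6 * c + 7 + (2 * c + 1)      ≡⟨ lemma′ c ⟩
        8 * suc c                    ≤⟨ *-monoʳ-≤ 8 (n<2^n c) ⟩
        8 * 2 ^ c                    ≤⟨ *-monoʳ-≤ 8 (^-monoʳ-≤ 2 (m≤m+n c (c + 0))) ⟩
        8 * 2 ^ (2 * c)              ≡⟨ ^-distribˡ-+-* 2 3 (2 * c) ⟨
        2 ^ (3 + 2 * c)              ∎) ⟩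
      2 ^ c * 2 ^ (3 + 2 * c)       ≡⟨ ^-distribˡ-+-* 2 c (3 + 2 * c) ⟨
      2 ^ j₀ ∎
      where
      lemma : ∀ c → suc (2 * (c + (3 + 2 * c))) ≡ 6 * c + 7
      lemma = solve-∀
      lemma′ : ∀ c → 6 * c + 7 + (2 * c + 1) ≡ 8 * suc c
      lemma′ = solve-∀

    go : ∀ i → c * suc (2 * (j₀ + i)) ≤ 2 ^ (j₀ + i)
    go zero    = subst (λ j → c * suc (2 * j) ≤ 2 ^ j) (sym (+-identityʳ j₀)) base
    go (suc i) = subst (λ j → c * suc (2 * j) ≤ 2 ^ j) (sym (+-suc j₀ i)) (begin
      c * suc (2 * suc (j₀ + i))          ≡⟨ lemma c (j₀ + i) ⟩
      c * suc (2 * (j₀ + i)) + c * 2      ≤⟨ +-mono-≤ (go i) (≤-trans (*-monoʳ-≤ c 2≤) (go i)) ⟩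
      2 ^ (j₀ + i) + 2 ^ (j₀ + i)         ≡⟨ cong (2 ^ (j₀ + i) +_) (+-identityʳ _) ⟨
      2 ^ suc (j₀ + i) ∎)
      where
      lemma : ∀ c j → c * suc (2 * suc j) ≡ c * suc (2 * j) + c * 2
      lemma = solve-∀
      2≤ : 2 ≤ suc (2 * (j₀ + i))
      2≤ = s≤s (≤-trans (≤-trans (s≤s z≤n) (m≤n+m (3 + 2 * c) c)) (≤-trans (m≤m+n j₀ i) (m≤m+n _ _)))

  log₄ : ∀ j₀ n → 4 ^ j₀ ≤ n → ∃[ j ] j₀ ≤ j × 4 ^ j ≤ n × n < 4 ^ suc j
  log₄ j₀ zero    le = contradiction (≤-trans (m^n>0 4 j₀) le) λ ()
  log₄ j₀ (suc n) le with 4 ^ j₀ ≤? n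
  ... | no ≰   = j₀ , ≤-refl , le , ≤-<-trans (≰⇒> ≰) (^-monoʳ-< 4 (s≤s (s≤s z≤n)) (n<1+n j₀))
  ... | yes le′ with j , j₀≤j , lo , hi ← log₄ j₀ n le′ | suc n <? 4 ^ suc j
  ...   | yes <  = j , j₀≤j , m≤n⇒m≤1+n lo , <
  ...   | no ≮   = suc j , m≤n⇒m≤1+n j₀≤j , ≮⇒≥ ≮ ,
                   ≤-<-trans hi (^-monoʳ-< 4 (s≤s (s≤s z≤n)) (n<1+n (suc j)))

open Tallies using (sequences)
open FreeFamilies using (binomialSum; numberOfFree-lower; numberOfFree-upper)
open Estimates
open import Data.Integer using (∣_∣; +_; -[1+_]; +[1+_])
import Data.Integer as ℤ
open import Data.Integer.DivMod using (div-pos-is-/ℕ)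
import Data.Integer.Properties as ℤ
import Data.Integer.Tactic.RingSolver as ℤ
open import Data.Nat.DivMod using (m≡m%n+[m/n]*n; m%n<n; m/n*n≤m)
open import Data.Rational.Unnormalised
  using (ℚᵘ; mkℚᵘ; 0ℚᵘ; 1ℚᵘ; _+_; _-_; _*_; _≤_; _<_; _≃_; *≤*; *<*; *≡*; floor; positive; Positive)
import Data.Rational.Unnormalised.Properties as ℚ

-- Rational exponents

private
  integral+fraction : ∀ x e b → mkℚᵘ x 0 + mkℚᵘ e b ≃ mkℚᵘ (x ℤ.* + suc b ℤ.+ e) b
  integral+fraction x e b = *≡* (subst
    (λ c → (x ℤ.* + suc b ℤ.+ e ℤ.* + 1) ℤ.* + suc b ≡ (x ℤ.* + suc b ℤ.+ e) ℤ.* + suc c)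
    (sym (ℕ.+-identityʳ b)) (lemma x e (+ suc b)))
    where
    lemma : ∀ x e d → (x ℤ.* d ℤ.+ e ℤ.* + 1) ℤ.* d ≡ (x ℤ.* d ℤ.+ e) ℤ.* d
    lemma = ℤ.solve-∀

  fraction*integral : ∀ y m b → mkℚᵘ y b * mkℚᵘ m 0 ≃ mkℚᵘ (y ℤ.* m) b
  fraction*integral y m b = *≡* (cong (λ c → y ℤ.* m ℤ.* + suc c) (sym (ℕ.*-identityʳ b)))

  suc-1 : ∀ k → fromℕ (suc k) - 1ℚᵘ ≃ fromℕ k
  suc-1 k = *≡* (cong (ℤ._* + 1) (lemma (+ k)))
    where
    lemma : ∀ x → (+ 1 ℤ.+ x) ℤ.* + 1 ℤ.+ (ℤ.- + 1) ℤ.* + 1 ≡ x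
    lemma = ℤ.solve-∀

  -- With h = k + 1, the exponent becomes one fraction over the denominator of ε; the integer e
  -- serves both signs of ε.
  exponent : ∀ k e b M → (fromℕ (suc k) - 1ℚᵘ + mkℚᵘ e b) * fromℕ M ≃
                         mkℚᵘ ((+ k ℤ.* + suc b ℤ.+ e) ℤ.* + M) b
  exponent k e b M = begin
    (fromℕ (suc k) - 1ℚᵘ + mkℚᵘ e b) * fromℕ M  ≈⟨ ℚ.*-congʳ (ℚ.+-congˡ (mkℚᵘ e b) (suc-1 k)) ⟩
    (fromℕ k + mkℚᵘ e b) * fromℕ M              ≈⟨ ℚ.*-congʳ (integral+fraction (+ k) e b) ⟩
    mkℚᵘ (+ k ℤ.* + suc b ℤ.+ e) b * fromℕ M    ≈⟨ fraction*integral (+ k ℤ.* + suc b ℤ.+ e) (+ M) b ⟩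
    mkℚᵘ ((+ k ℤ.* + suc b ℤ.+ e) ℤ.* + M) b    ∎
    where open ℚ.≃-Reasoning

  pos-numerator : ∀ k b a M → (+ k ℤ.* + suc b ℤ.+ + a) ℤ.* + M ≡ + ((k ℕ.* suc b ℕ.+ a) ℕ.* M)
  pos-numerator k b a M = begin
    (+ k ℤ.* + suc b ℤ.+ + a) ℤ.* + M ≡⟨ cong (λ y → (y ℤ.+ + a) ℤ.* + M) (ℤ.pos-* k (suc b)) ⟨
    + (k ℕ.* suc b ℕ.+ a) ℤ.* + M     ≡⟨ ℤ.pos-* (k ℕ.* suc b ℕ.+ a) M ⟨
    + ((k ℕ.* suc b ℕ.+ a) ℕ.* M)     ∎
    where open ≡-Reasoning

exponent⁺≤ : ∀ k a b M L → (k ℕ.* suc b ℕ.+ a) ℕ.* M ℕ.≤ L ℕ.* suc b →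
             (fromℕ (suc k) - 1ℚᵘ + mkℚᵘ (+ a) b) * fromℕ M ≤ fromℕ L
exponent⁺≤ k a b M L le = ℚ.≤-respˡ-≃ (ℚ.≃-sym (exponent k (+ a) b M)) (*≤* (begin
  (+ k ℤ.* + suc b ℤ.+ + a) ℤ.* + M ℤ.* + 1 ≡⟨ ℤ.*-identityʳ _ ⟩
  (+ k ℤ.* + suc b ℤ.+ + a) ℤ.* + M         ≡⟨ pos-numerator k b a M ⟩
  + ((k ℕ.* suc b ℕ.+ a) ℕ.* M)             ≤⟨ ℤ.+≤+ le ⟩
  + (L ℕ.* suc b)                           ≡⟨ ℤ.pos-* L (suc b) ⟩
  + L ℤ.* + suc b                           ∎))
  where open ℤ.≤-Reasoning

≤exponent⁺ : ∀ k a b M L → L ℕ.* suc b ℕ.≤ (k ℕ.* suc b ℕ.+ a) ℕ.* M →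
             fromℕ L ≤ (fromℕ (suc k) - 1ℚᵘ + mkℚᵘ (+ a) b) * fromℕ M
≤exponent⁺ k a b M L le = ℚ.≤-respʳ-≃ (ℚ.≃-sym (exponent k (+ a) b M)) (*≤* (begin
  + L ℤ.* + suc b                           ≡⟨ ℤ.pos-* L (suc b) ⟨
  + (L ℕ.* suc b)                           ≤⟨ ℤ.+≤+ le ⟩
  + ((k ℕ.* suc b ℕ.+ a) ℕ.* M)             ≡⟨ pos-numerator k b a M ⟨
  (+ k ℤ.* + suc b ℤ.+ + a) ℤ.* + M         ≡⟨ ℤ.*-identityʳ _ ⟨
  (+ k ℤ.* + suc b ℤ.+ + a) ℤ.* + M ℤ.* + 1 ∎))
  where open ℤ.≤-Reasoning

-- The subtracted term moves to the other side, so the premise is about naturals even when the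
-- exponent is negative.
exponent⁻≤ : ∀ k a b M L → k ℕ.* suc b ℕ.* M ℕ.≤ L ℕ.* suc b ℕ.+ a ℕ.* M →
             (fromℕ (suc k) - 1ℚᵘ - mkℚᵘ (+ a) b) * fromℕ M ≤ fromℕ L
exponent⁻≤ k a b M L le = ℚ.≤-respˡ-≃ (ℚ.≃-sym (exponent k (ℤ.- + a) b M)) (*≤* (begin
  (+ k ℤ.* + suc b ℤ.+ ℤ.- + a) ℤ.* + M ℤ.* + 1  ≡⟨ lemma (+ k) (+ suc b) (+ a) (+ M) ⟩
  + k ℤ.* + suc b ℤ.* + M ℤ.- + a ℤ.* + M
    ≡⟨ cong₂ ℤ._-_ (trans (ℤ.pos-* (k ℕ.* suc b) M) (cong (ℤ._* + M) (ℤ.pos-* k (suc b)))) (ℤ.pos-* a M) ⟨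
  + (k ℕ.* suc b ℕ.* M) ℤ.- + (a ℕ.* M)          ≤⟨ ℤ.+-monoˡ-≤ (ℤ.- + (a ℕ.* M)) (ℤ.+≤+ le) ⟩
  + (L ℕ.* suc b) ℤ.+ + (a ℕ.* M) ℤ.- + (a ℕ.* M) ≡⟨ lemma′ (+ (L ℕ.* suc b)) (+ (a ℕ.* M)) ⟩
  + (L ℕ.* suc b)                                ≡⟨ ℤ.pos-* L (suc b) ⟩
  + L ℤ.* + suc b                                ∎))
  where
  open ℤ.≤-Reasoning
  lemma : ∀ k b a M → (k ℤ.* b ℤ.+ ℤ.- a) ℤ.* M ℤ.* + 1 ≡ k ℤ.* b ℤ.* M ℤ.- a ℤ.* M
  lemma = ℤ.solve-∀
  lemma′ : ∀ x y → x ℤ.+ y ℤ.- y ≡ x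
  lemma′ = ℤ.solve-∀

≤2^⁺ : ∀ {m} L q → m ℕ.≤ 2 ^ L → fromℕ L ≤ q → m ≤2^ q
≤2^⁺ {m} L (mkℚᵘ (+ a) b) m≤ (*≤* le) = begin
  m ^ suc b         ≤⟨ ℕ.^-monoˡ-≤ (suc b) m≤ ⟩
  (2 ^ L) ^ suc b   ≡⟨ ℕ.^-*-assoc 2 L (suc b) ⟩
  2 ^ (L ℕ.* suc b)
    ≤⟨ ℕ.^-monoʳ-≤ 2 (ℤ.drop‿+≤+ (subst₂ ℤ._≤_ (sym (ℤ.pos-* L (suc b))) (ℤ.*-identityʳ (+ a)) le)) ⟩
  2 ^ a             ∎
  where
  open ℕ.≤-Reasoning
≤2^⁺ L (mkℚᵘ -[1+ a ] b) _ (*≤* le)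
  with () ← subst (ℤ._≤ -[1+ a ] ℤ.* + 1) (sym (ℤ.pos-* L (suc b))) le

2^≤⁺ : ∀ {m} L q → 2 ^ L ℕ.≤ m → q ≤ fromℕ L → 2^ q ≤ m
2^≤⁺ {m} L (mkℚᵘ (+ a) b) ≤m (*≤* le) = begin
  2 ^ a
    ≤⟨ ℕ.^-monoʳ-≤ 2 (ℤ.drop‿+≤+ (subst₂ ℤ._≤_ (ℤ.*-identityʳ (+ a)) (sym (ℤ.pos-* L (suc b))) le)) ⟩
  2 ^ (L ℕ.* suc b) ≡⟨ ℕ.^-*-assoc 2 L (suc b) ⟨
  (2 ^ L) ^ suc b   ≤⟨ ℕ.^-monoˡ-≤ (suc b) ≤m ⟩
  m ^ suc b         ∎
  where
  open ℕ.≤-Reasoning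
-- For a negative exponent it suffices that m ≥ 2^L ≥ 1.
2^≤⁺ L (mkℚᵘ -[1+ a ] b) ≤m _ =
  ℕ.*-mono-≤ {1} {_} {1} (ℕ.≤-trans (ℕ.≤-reflexive (sym (ℕ.^-zeroˡ (suc b))))
                    (ℕ.^-monoˡ-≤ (suc b) (ℕ.≤-trans (ℕ.m^n>0 2 L) ≤m)))
             (ℕ.m^n>0 2 (suc a))

-- Since δ ≥ 1/(b + 1), the floor q satisfies n < (q + 1)(b + 1). With n ≥ b + 1 this forces q ≥ 1,
-- and then q + 1 ≤ 2q.
floor-lower : ∀ a b n → suc b ℕ.≤ n →
  NonZero ∣ floor (mkℚᵘ +[1+ a ] b * fromℕ n) ∣ ×
  n ℕ.≤ 2 ℕ.* suc b ℕ.* ∣ floor (mkℚᵘ +[1+ a ] b * fromℕ n) ∣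
floor-lower a b n b≤n = subst (λ d → NonZero d × n ℕ.≤ 2 ℕ.* suc b ℕ.* d) (sym floor≡)
                           (nonZero quotient n<′ , bound quotient n<′)
  where
  numerator = suc a ℕ.* n
  denominator = suc (b ℕ.* 1)
  quotient = numerator ℕ./ denominator

  floor≡ : ∣ floor (mkℚᵘ +[1+ a ] b * fromℕ n) ∣ ≡ quotient
  floor≡ = cong ∣_∣ (trans (div-pos-is-/ℕ (+[1+ a ] ℤ.* + n) denominator)
                       (cong (ℤ._/ℕ denominator) (sym (ℤ.pos-* (suc a) n))))

  n<′ : n ℕ.< suc quotient ℕ.* suc b
  n<′ = begin-strict
    n                                                        ≤⟨ ℕ.m≤m+n n (a ℕ.* n) ⟩
    numerator                                                ≡⟨ m≡m%n+[m/n]*n numerator denominator ⟩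
    numerator ℕ.% denominator ℕ.+ quotient ℕ.* denominator   <⟨ ℕ.+-monoˡ-< _ (m%n<n numerator denominator) ⟩
    suc quotient ℕ.* denominator                             ≡⟨ cong (λ c → suc quotient ℕ.* suc c) (ℕ.*-identityʳ b) ⟩
    suc quotient ℕ.* suc b                                   ∎
    where open ℕ.≤-Reasoning

  nonZero : ∀ q → n ℕ.< suc q ℕ.* suc b → NonZero q
  nonZero zero    n< = contradiction (ℕ.<-≤-trans n< (ℕ.≤-trans (ℕ.≤-reflexive (ℕ.+-identityʳ _)) b≤n)) (ℕ.<-irrefl refl)
  nonZero (suc q) _  = _

  bound : ∀ q → n ℕ.< suc q ℕ.* suc b → n ℕ.≤ 2 ℕ.* suc b ℕ.* q
  bound zero    n< = contradiction (nonZero zero n<) λ ()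
  bound (suc q) n< = ℕ.≤-trans (ℕ.<⇒≤ n<) (ℕ.≤-trans (ℕ.m≤m+n _ (q ℕ.* suc b)) (ℕ.≤-reflexive (lemma b q)))
    where
    lemma : ∀ b q → suc (suc q) ℕ.* suc b ℕ.+ q ℕ.* suc b ≡ 2 ℕ.* suc b ℕ.* suc q
    lemma = ℕ.solve-∀

-- Asymptotics

-- Here 2^n = 2^(2j) s with 2^(2j) ~ n, and r bounds 2^n / d because n ≤ 2βd.
module Threshold (n j β p D : ℕ) (4^j≤n : 4 ^ j ℕ.≤ n) (n<4^1+j : n ℕ.< 4 ^ suc j)
  (small : 4 ℕ.* (D ℕ.* suc (p ℕ.* (2 ℕ.* β))) ℕ.* suc (2 ℕ.* j) ℕ.≤ 2 ^ j) where
  open ℕ.≤-Reasoning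

  s r : ℕ
  s = 2 ^ (n ℕ.∸ 2 ℕ.* j)
  r = 2 ℕ.* β ℕ.* s

  2^2j*s : 2 ^ (2 ℕ.* j) ℕ.* s ≡ 2 ^ n
  2^2j*s = trans (sym (ℕ.^-distribˡ-+-* 2 (2 ℕ.* j) _)) (cong (2 ^_) (ℕ.m+[n∸m]≡n (begin
    2 ℕ.* j       ≤⟨ ℕ.<⇒≤ (n<2^n (2 ℕ.* j)) ⟩
    2 ^ (2 ℕ.* j) ≡⟨ ℕ.^-*-assoc 2 2 j ⟨
    4 ^ j         ≤⟨ 4^j≤n ⟩
    n             ∎)))

  2^n≤d*r : ∀ d → n ℕ.≤ 2 ℕ.* β ℕ.* d → 2 ^ n ℕ.≤ d ℕ.* r
  2^n≤d*r d n≤ = begin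
    2 ^ n                   ≡⟨ 2^2j*s ⟨
    2 ^ (2 ℕ.* j) ℕ.* s     ≡⟨ cong (ℕ._* s) (ℕ.^-*-assoc 2 2 j) ⟨
    4 ^ j ℕ.* s             ≤⟨ ℕ.*-monoˡ-≤ s (ℕ.≤-trans 4^j≤n n≤) ⟩
    2 ℕ.* β ℕ.* d ℕ.* s     ≡⟨ lemma β d s ⟩
    d ℕ.* (2 ℕ.* β ℕ.* s)   ∎
    where
    lemma : ∀ β d s → 2 ℕ.* β ℕ.* d ℕ.* s ≡ d ℕ.* (2 ℕ.* β ℕ.* s)
    lemma = ℕ.solve-∀

  error : ℕ
  error = s ℕ.+ suc (2 ℕ.* j) ℕ.* (p ℕ.* r)

  sequences≤ : sequences (2 ^ n) (p ℕ.* r) ℕ.≤ 2 ^ error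
  sequences≤ = subst (λ a → sequences a (p ℕ.* r) ℕ.≤ 2 ^ error) 2^2j*s (sequences≤2^ (2 ℕ.* j) s (p ℕ.* r))

  -- As s = 2^n / 4^j, the error is of order j 2^n / 4^j, while `central n` is at least 2^n / (4 ·
  -- 2^j); `small` absorbs the constants and D into the ratio j / 2^j.
  error≤central : error ℕ.* D ℕ.≤ central n
  error≤central = ℕ.*-cancelˡ-≤ (4 ℕ.* (2 ^ j ℕ.* 2 ^ j)) {{ℕ.>-nonZero (ℕ.*-mono-≤ {1} {4} (s≤s z≤n) (ℕ.*-mono-≤ (ℕ.m^n>0 2 j) (ℕ.m^n>0 2 j)))}} (begin
    4 ℕ.* (2 ^ j ℕ.* 2 ^ j) ℕ.* (error ℕ.* D)
      -- Adding 2jsD turns the summand s of `error` into (2j + 1)s, which then factors out.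
      ≤⟨ ℕ.*-monoʳ-≤ (4 ℕ.* (2 ^ j ℕ.* 2 ^ j)) (ℕ.≤-trans (ℕ.m≤m+n _ (2 ℕ.* j ℕ.* s ℕ.* D)) (ℕ.≤-reflexive (lemma s j p β D))) ⟩
    4 ℕ.* (2 ^ j ℕ.* 2 ^ j) ℕ.* (D ℕ.* suc (p ℕ.* (2 ℕ.* β)) ℕ.* suc (2 ℕ.* j) ℕ.* s)
      ≡⟨ lemma₂ (2 ^ j) (D ℕ.* suc (p ℕ.* (2 ℕ.* β))) (suc (2 ℕ.* j)) s ⟩
    4 ℕ.* (D ℕ.* suc (p ℕ.* (2 ℕ.* β))) ℕ.* suc (2 ℕ.* j) ℕ.* (2 ^ j ℕ.* 2 ^ j ℕ.* s)
      ≤⟨ ℕ.*-monoˡ-≤ (2 ^ j ℕ.* 2 ^ j ℕ.* s) small ⟩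
    2 ^ j ℕ.* (2 ^ j ℕ.* 2 ^ j ℕ.* s)
      ≡⟨ cong (λ y → 2 ^ j ℕ.* (y ℕ.* s)) (trans (sym (*-^-distrib j 2 2)) (ℕ.^-*-assoc 2 2 j)) ⟩
    2 ^ j ℕ.* (2 ^ (2 ℕ.* j) ℕ.* s)     ≡⟨ cong (2 ^ j ℕ.*_) 2^2j*s ⟩
    2 ^ j ℕ.* 2 ^ n                     ≤⟨ ℕ.*-monoʳ-≤ (2 ^ j) (2^≤central n j n<4^1+j) ⟩
    2 ^ j ℕ.* (central n ℕ.* (4 ℕ.* 2 ^ j)) ≡⟨ lemma₃ (2 ^ j) (central n) ⟩
    4 ℕ.* (2 ^ j ℕ.* 2 ^ j) ℕ.* central n ∎)
    where
    lemma : ∀ s j p β D →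
      (s ℕ.+ suc (2 ℕ.* j) ℕ.* (p ℕ.* (2 ℕ.* β ℕ.* s))) ℕ.* D ℕ.+ 2 ℕ.* j ℕ.* s ℕ.* D ≡
      D ℕ.* suc (p ℕ.* (2 ℕ.* β)) ℕ.* suc (2 ℕ.* j) ℕ.* s
    lemma = ℕ.solve-∀
    lemma₂ : ∀ y c l s → 4 ℕ.* (y ℕ.* y) ℕ.* (c ℕ.* l ℕ.* s) ≡ 4 ℕ.* c ℕ.* l ℕ.* (y ℕ.* y ℕ.* s)
    lemma₂ = ℕ.solve-∀
    lemma₃ : ∀ y c → y ℕ.* (c ℕ.* (4 ℕ.* y)) ≡ 4 ℕ.* (y ℕ.* y) ℕ.* c
    lemma₃ = ℕ.solve-∀

-- The loss k³/m in `binomialSum-lower`, relative to `central n`, is less than 1/(b + 1), hence less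
-- than ε = (a + 1)/(b + 1).
middleLayers-lower : ∀ n k a b → suc b ℕ.* (k ℕ.* k ℕ.* k) ℕ.< ⌊ n /2⌋ →
  k ℕ.* suc b ℕ.* central n ℕ.≤ binomialSum n ⌊ n /2⌋ k ℕ.* suc b ℕ.+ suc a ℕ.* central n
middleLayers-lower n k a b large = ℕ.*-cancelˡ-≤ m {{ℕ.>-nonZero (ℕ.≤-<-trans z≤n large)}} (begin
  m ℕ.* (k ℕ.* suc b ℕ.* M)             ≡⟨ lemma m k b M ⟩
  suc b ℕ.* (m ℕ.* (k ℕ.* M))           ≤⟨ ℕ.*-monoʳ-≤ (suc b) (binomialSum-lower n k) ⟩
  suc b ℕ.* (m ℕ.* L ℕ.+ k ℕ.* k ℕ.* k ℕ.* M) ≡⟨ lemma′ m L k b M ⟩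
  m ℕ.* (L ℕ.* suc b) ℕ.+ suc b ℕ.* (k ℕ.* k ℕ.* k) ℕ.* M
    ≤⟨ ℕ.+-monoʳ-≤ _ (ℕ.*-mono-≤ (ℕ.<⇒≤ large) (ℕ.m≤m+n M (a ℕ.* M))) ⟩
  m ℕ.* (L ℕ.* suc b) ℕ.+ m ℕ.* (suc a ℕ.* M) ≡⟨ ℕ.*-distribˡ-+ m (L ℕ.* suc b) (suc a ℕ.* M) ⟨
  m ℕ.* (L ℕ.* suc b ℕ.+ suc a ℕ.* M)   ∎)
  where
  open ℕ.≤-Reasoning
  m = ⌊ n /2⌋
  M = central n
  L = binomialSum n m k
  lemma : ∀ m k b M → m ℕ.* (k ℕ.* suc b ℕ.* M) ≡ suc b ℕ.* (m ℕ.* (k ℕ.* M))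
  lemma = ℕ.solve-∀
  lemma′ : ∀ m L k b M → suc b ℕ.* (m ℕ.* L ℕ.+ k ℕ.* k ℕ.* k ℕ.* M) ≡
                         m ℕ.* (L ℕ.* suc b) ℕ.+ suc b ℕ.* (k ℕ.* k ℕ.* k) ℕ.* M
  lemma′ = ℕ.solve-∀

-- The two bounds for a fixed ε.

height-positive : (P : FinPoset) → FinPoset.Element P → ∀ {h} → FinPoset.IsHeight P h → 0 ℕ.< h
height-positive P x height = proj₂ height [ x ] (([] ∷ []) , ([] ∷ []))

lowerBound : ∀ (P : FinPoset) {k} → FinPoset.IsHeight P (suc k) → ∀ a b →
  ∃[ N ] ∀ n → n ≥ N → 2^ ((fromℕ (suc k) - 1ℚᵘ - mkℚᵘ +[1+ a ] b) * middle n) ≤ numberOfFree P n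
lowerBound P {k} height a b = c ℕ.+ c , λ n n≥ →
  2^≤⁺ (binomialSum n ⌊ n /2⌋ k) _ (numberOfFree-lower P height ℕ.≤-refl n ⌊ n /2⌋)
    (exponent⁻≤ k (suc a) b (central n) (binomialSum n ⌊ n /2⌋ k)
      (middleLayers-lower n k a b
        (ℕ.≤-trans (ℕ.≤-reflexive (ℕ.n≡⌊n+n/2⌋ c)) (ℕ.⌊n/2⌋-mono n≥))))
  where
  c = suc (suc b ℕ.* (k ℕ.* k ℕ.* k))

module _ (P : FinPoset) (tree : IsTree P) (x : FinPoset.Element P) (k : ℕ) where

  BlowupsIn : ℚᵘ → ℚᵘ → Set
  BlowupsIn ε δ = ∃[ N ] ∀ n → n ≥ N → (F : List (Subset n)) → Unique F →
    (fromℕ (suc k) - 1ℚᵘ + ε) * middle n ≤ fromℕ (length F) →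
    Contains F (blowUp P tree x ∣ floor (δ * fromℕ n) ∣)

  -- The entry `b ℕ.+ suc b` encodes the denominator 2(b + 1), so blow-ups are used at ε/2; the
  -- other ε/2 pays for `error`.
  upperBound : ∀ a b δ → Positive δ → BlowupsIn (mkℚᵘ +[1+ a ] (b ℕ.+ suc b)) δ →
    ∃[ N ] ∀ n → n ≥ N → numberOfFree P n ≤2^ ((fromℕ (suc k) - 1ℚᵘ + mkℚᵘ +[1+ a ] b) * middle n)
  upperBound a b (mkℚᵘ +[1+ δₐ ] δᵦ) _ (N , contains) =
    N′ , λ n n≥ → bound n n≥ (log₄ j₀ n (ℕ.≤-trans (ℕ.m≤n+m (4 ^ j₀) (N ℕ.+ β)) n≥))
    where
    β D p j₀ N′ : ℕ
    β = suc δᵦ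
    D = suc b ℕ.+ suc b
    p = FinPoset.size P
    j₀ = proj₁ (linear≤2^ (4 ℕ.* (D ℕ.* suc (p ℕ.* (2 ℕ.* β)))))
    small : ∀ j → j₀ ℕ.≤ j → 4 ℕ.* (D ℕ.* suc (p ℕ.* (2 ℕ.* β))) ℕ.* suc (2 ℕ.* j) ℕ.≤ 2 ^ j
    small = proj₂ (linear≤2^ (4 ℕ.* (D ℕ.* suc (p ℕ.* (2 ℕ.* β)))))
    -- N serves the blow-ups, β a nonzero block size, and 4^j₀ the choice of j ≥ j₀ in `log₄`.
    N′ = N ℕ.+ β ℕ.+ 4 ^ j₀

    bound : ∀ n → n ≥ N′ → ∃[ j ] j₀ ℕ.≤ j × 4 ^ j ℕ.≤ n × n ℕ.< 4 ^ suc j →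
            numberOfFree P n ≤2^ ((fromℕ (suc k) - 1ℚᵘ + mkℚᵘ +[1+ a ] b) * middle n)
    bound n n≥ (j , j₀≤j , lo , hi) = ≤2^⁺ (T ℕ.+ error) _ count
      (≤exponent⁺ k (suc a) b M (T ℕ.+ error) size≤)
      where
      open Threshold n j β p D lo hi (small j j₀≤j)
      open ℕ.≤-Reasoning
      M = central n
      X = (k ℕ.* D ℕ.+ suc a) ℕ.* M
      -- The threshold (h - 1 + ε/2) `central n`, rounded down; families with more than T sets
      -- contain blow-ups.
      T = X ℕ./ D
      d = ∣ floor (mkℚᵘ +[1+ δₐ ] δᵦ * fromℕ n) ∣

      n≥N : n ≥ N
      n≥N = ℕ.≤-trans (ℕ.m≤m+n N β) (ℕ.≤-trans (ℕ.m≤m+n (N ℕ.+ β) (4 ^ j₀)) n≥)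
      n≥β : n ≥ β
      n≥β = ℕ.≤-trans (ℕ.m≤n+m β N) (ℕ.≤-trans (ℕ.m≤m+n (N ℕ.+ β) (4 ^ j₀)) n≥)

      many : ∀ (F : List (Subset n)) → T ℕ.< length F → X ℕ.≤ length F ℕ.* D
      many F T< = begin
        X                         ≡⟨ m≡m%n+[m/n]*n X D ⟩
        X ℕ.% D ℕ.+ T ℕ.* D       ≤⟨ ℕ.+-monoˡ-≤ (T ℕ.* D) (ℕ.<⇒≤ (m%n<n X D)) ⟩
        suc T ℕ.* D               ≤⟨ ℕ.*-monoˡ-≤ D T< ⟩
        length F ℕ.* D            ∎

      count : numberOfFree P n ℕ.≤ 2 ^ (T ℕ.+ error)
      count = begin
        numberOfFree P n
          ≤⟨ numberOfFree-upper P tree x d {{proj₁ (floor-lower δₐ δᵦ n n≥β)}} n T _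
               (2^n≤d*r d (proj₂ (floor-lower δₐ δᵦ n n≥β)))
               (λ F F! T< → contains n n≥N F F! (exponent⁺≤ k (suc a) (b ℕ.+ suc b) M (length F) (many F T<))) ⟩
        2 ^ T ℕ.* sequences (2 ^ n) (p ℕ.* r)
          ≤⟨ ℕ.*-monoʳ-≤ (2 ^ T) sequences≤ ⟩
        2 ^ T ℕ.* 2 ^ error ≡⟨ ℕ.^-distribˡ-+-* 2 T error ⟨
        2 ^ (T ℕ.+ error) ∎

      size≤ : (T ℕ.+ error) ℕ.* suc b ℕ.≤ (k ℕ.* suc b ℕ.+ suc a) ℕ.* M
      size≤ = ℕ.*-cancelˡ-≤ 2 (begin
        2 ℕ.* ((T ℕ.+ error) ℕ.* suc b)   ≡⟨ lemma T error b ⟩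
        T ℕ.* D ℕ.+ error ℕ.* D           ≤⟨ ℕ.+-mono-≤ (m/n*n≤m X D) (ℕ.≤-trans (error≤central) (ℕ.m≤m+n M (a ℕ.* M))) ⟩
        X ℕ.+ suc a ℕ.* M             ≡⟨ lemma′ k b a M ⟩
        2 ℕ.* ((k ℕ.* suc b ℕ.+ suc a) ℕ.* M) ∎)
        where
        lemma : ∀ T e b → 2 ℕ.* ((T ℕ.+ e) ℕ.* suc b) ≡ T ℕ.* (suc b ℕ.+ suc b) ℕ.+ e ℕ.* (suc b ℕ.+ suc b)
        lemma = ℕ.solve-∀
        lemma′ : ∀ k b a M → (k ℕ.* (suc b ℕ.+ suc b) ℕ.+ suc a) ℕ.* M ℕ.+ suc a ℕ.* M ≡
                             2 ℕ.* ((k ℕ.* suc b ℕ.+ suc a) ℕ.* M)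
        lemma′ = ℕ.solve-∀

theorem1p6 : (P : FinPoset) (tree : IsTree P) (h : ℕ) → FinPoset.IsHeight P h →
    (x : FinPoset.Element P) →
    (∀ (ε : ℚᵘ) → 0ℚᵘ < ε →
    ∃[ δ ] 0ℚᵘ < δ × (∃[ N ] ∀ n → n ≥ N →
    (F : List (Subset n)) → Unique F →
    (fromℕ h - 1ℚᵘ + ε) * middle n ≤ fromℕ (length F) →
    Contains F (blowUp P tree x ∣ floor (δ * fromℕ n) ∣))) →
    ∀ (ε : ℚᵘ) → 0ℚᵘ < ε →
    ∃[ N ] ∀ n → n ≥ N →
    (2^ ((fromℕ h - 1ℚᵘ - ε) * middle n) ≤ numberOfFree P n)
    × (numberOfFree P n ≤2^ ((fromℕ h - 1ℚᵘ + ε) * middle n))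
theorem1p6 P tree zero height x _ _ _ = contradiction (height-positive P x height) λ ()
theorem1p6 P tree (suc k) height x blowups ε 0<ε = bounds ε (positive 0<ε)
  where
  bounds : ∀ ε → Positive ε → ∃[ N ] ∀ n → n ≥ N →
    (2^ ((fromℕ (suc k) - 1ℚᵘ - ε) * middle n) ≤ numberOfFree P n)
    × (numberOfFree P n ≤2^ ((fromℕ (suc k) - 1ℚᵘ + ε) * middle n))
  bounds (mkℚᵘ +[1+ a ] b) _ =
    let δ , 0<δ , contains = blowups (mkℚᵘ +[1+ a ] (b ℕ.+ suc b)) (*<* (ℤ.+<+ (s≤s z≤n)))
        N₁ , lower = lowerBound P height a b
        N₂ , upper = upperBound P tree x k a b δ (positive 0<δ) contains
    in N₁ ℕ.+ N₂ , λ n n≥ →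
         lower n (ℕ.≤-trans (ℕ.m≤m+n N₁ N₂) n≥) , upper n (ℕ.≤-trans (ℕ.m≤n+m N₂ N₁) n≥)
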